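{- For each integer $\alpha\ge 3$ let $m=2^\alpha$ and let $S=R_1R_2\cdots R_{m-1}$ be the string defined in the context, and let $n=|S|=m^2-1$. For any function $h:\mathbb{Z}_{\ge 1}\to\mathbb{Z}_{\ge 1}$, the following statements hold, where the asymptotic notation refers to $n$ ranging over the lengths of these strings as $\alpha\to\infty$. 1. If $h(n)\in O(\operatorname{polylog} n)$, then $\hat z_{h(n)}(S)/z(S)\in\Omega\left(\frac{\log n}{\log\log n}\right)$. 2. If $\hat z_{h(n)}(S)\in O(z(S))$, then $h(n)\in n^{\Omega(1)}$.
   Context: Notation: $\mathbb{Z}_n=\{0,\dots,n-1\}$. Strings are indexed from $0$; $S[i..j]$ is the substring from position $i$ to $j$. $O(\operatorname{polylog} n)$ means $O((\log n)^k)$ for some constant $k$. The strings: for $k\ge0$ the bit-reversal permutation $\pi_k:\mathbb{Z}_{2^k}\to\mathbb{Z}_{2^k}$ maps $x$ to the integer whose $k$-bit binary representation is the reversal of the $k$-bit binary representation of $x$. For $\alpha\ge3$, $m=2^\alpha$, take distinct characters $\mathtt{a}_i$ ($i\in\mathbb{Z}_m$), $\mathtt{b}$, and $\mathtt{\$}_x$ ($1\le x\le m-1$). For $1\le x\le m-1$, $R_x$ is the string of length $m+1$ with, for $i\in\mathbb{Z}_m$, $R_x[i]=\mathtt{a}_i$ if $\pi_\alpha(i)<x$ and $R_x[i]=\mathtt{b}$ otherwise, and $R_x[m]=\mathtt{\$}_x$. LZ factorization: a factorization of $S$ is a sequence of nonempty phrases $F_1,\dots,F_f$ with $S=F_1\cdots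 F_f$; $F_j$ starts at $b_j=\sum_{k<j}|F_k|$. The LZ factorization is built left to right: if $S[b_j]$ has no occurrence starting before $b_j$ then $F_j=S[b_j]$; otherwise $F_j$ is the longest prefix of $S[b_j..|S|-1]$ with an occurrence starting before $b_j$ (overlap allowed). $z(S)$ is its number of phrases. LZ-like encodings: an LZ-like factorization of $S$ is a factorization in which every phrase $F_j$ is a single character or satisfies $F_j=S[p..p+|F_j|-1]$ for some $0\le p<b_j$. (The phrase containing the leftmost occurrence in $S$ of a character is then that single character.) An LZ-like encoding $\mathcal{E}=(\mathcal{F},s_1,\dots,s_f)$ of $S$ consists of an LZ-like factorization $\mathcal{F}=(F_1,\dots,F_f)$ together with, for each phrase $F_j$ having an earlier occurrence, a source position $s_j<b_j$ with $F_j=S[s_j..s_j+|F_j|-1]$, and $s_j=\bot$ for each phrase $F_j$ containing the leftmost occurrence of a character (exactly one phrase with $s_j=\bot$ for each character occurring in $S$). Its size is $f$. The transition function $\tau_{\mathcal{E}}:\mathbb{Z}_{|S|}\cup\{\bot\}\to\mathbb{Z}_{|S|}\cup\{\bot\}$ satisfies $\tau_{\mathcal{E}}(\bot)=\bot$ and, for $b_j\le i<b_j+|F_j|$, $\tau_{\mathcal{E}}(i)=\bot$ if $s_j=\bot$, and $\tau_{\mathcal{E}}(i)=s_j+((i-b_j)\bmod(b_j-s_j))$ otherwise. The depth of position $i$ is $\min\{k\ge0:\tau_{\mathcal{E}}^{k+1}(i)=\bot\}$, and the height of $\mathcal{E}$ is the maximum depth over all positions. For a positive integer $h$, $\hat z_h(S)$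 is the minimum size of an LZ-like encoding of $S$ of height at most $h$. -}

module Defs where

open import Data.Bool using (if_then_else_)
open import Data.Fin as Fin using (Fin; zero; suc; toℕ; fromℕ<; opposite; finToFun; funToFin)
import Data.Fin.Properties as Fin
open import Data.List
  using (List; []; _∷_; _++_; _∷ʳ_; [_]; length; map; concat; concatMap; take; drop; lookup; tabulate; applyUpTo; upTo)
open import Data.List.Extrema.Nat using (max; max≤v⁺)
open import Data.List.Membership.Propositional using (_∈_; find; lose)
open import Data.List.Membership.Propositional.Properties using (∈-concatMap⁺)
open import Data.List.Properties
  using (≡-dec; length-++; length-take; length-drop; length-tabulate; take++drop≡id;
         drop-drop; map-cong)
open import Data.List.Relation.Unary.All as All using (All; []; _∷_)
import Data.List.Relation.Unary.All.Properties as All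
open import Data.List.Relation.Unary.Any as Any using (here; there)
open import Data.Maybe using (Maybe; just; nothing)
open import Data.Nat
open import Data.Nat.DivMod using (_%_; m%n<n; m<n⇒m%n≡m)
open import Data.Nat.GeneralisedArithmetic using (fold)
open import Data.Nat.Induction using (<-rec)
open import Data.Nat.Logarithm using (⌊log₂_⌋)
open import Data.Nat.Properties
open import Data.Product using (∃; ∃-syntax; _×_; _,_; proj₁; proj₂)
open import Data.Sum using (_⊎_; inj₁; inj₂)
open import Function using (_∘_; id)
open import Relation.Binary using (DecidableEquality)
open import Relation.Binary.PropositionalEquality
  using (_≡_; _≢_; refl; sym; trans; cong; cong₂; subst; module ≡-Reasoning)
open import Relation.Nullary
open import Relation.Nullary.Decidable using (map′; _×-dec_; _⊎-dec_; ¬?)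
open import Relation.Unary using (Decidable)

IsLeast : (ℕ → Set) → ℕ → Set
IsLeast P m = P m × (∀ {k} → P k → m ≤ k)

IsLeast-unique : ∀ {P m n} → IsLeast P m → IsLeast P n → m ≡ n
IsLeast-unique (Pm , m≤) (Pn , n≤) = ≤-antisym (m≤ Pn) (n≤ Pm)

least : {P : ℕ → Set} → Decidable P → ∃ P → ∃ (IsLeast P)
least {P} P? (n , Pn) = go 0 n (λ ()) (subst P (sym (+-identityʳ n)) Pn)
  where
  go : ∀ m n → (∀ {k} → k < m → ¬ P k) → P (n + m) → ∃ (IsLeast P)
  go m zero    below p = m , p , λ Pk → ≮⇒≥ (λ k<m → below k<m Pk)
  go m (suc n) below p with P? m
  ... | yes Pm = m , Pm , λ Pk → ≮⇒≥ (λ k<m → below k<m Pk)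
  ... | no ¬Pm = go (suc m) n below′ (subst P (sym (+-suc n m)) p)
    where
    below′ : ∀ {k} → k < suc m → ¬ P k
    below′ (s≤s k≤m) with m≤n⇒m<n∨m≡n k≤m
    ... | inj₁ k<m  = below k<m
    ... | inj₂ refl = ¬Pm

greatest : {P : ℕ → Set} → Decidable P → ∀ b → ∃[ n ] n ≤ b × P n →
           ∃[ n ] n ≤ b × P n × (∀ {k} → k ≤ b → P k → k ≤ n)
greatest     P? zero    (zero , _ , p) = 0 , z≤n , p , λ k≤0 _ → k≤0
greatest {P} P? (suc b) (n , n≤ , p) with P? (suc b)
... | yes q = suc b , ≤-refl , q , λ k≤ _ → k≤
... | no ¬q with greatest P? b (n , lower n≤ p , p)
  where
  lower : ∀ {k} → k ≤ suc b → P k → k ≤ b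
  lower k≤ r with m≤n⇒m<n∨m≡n k≤
  ... | inj₁ (s≤s k≤b) = k≤b
  ... | inj₂ refl      = contradiction r ¬q
... | g , g≤ , pg , up = g , m≤n⇒m≤1+n g≤ , pg , up′
  where
  up′ : ∀ {k} → k ≤ suc b → P k → k ≤ g
  up′ k≤ r with m≤n⇒m<n∨m≡n k≤
  ... | inj₁ (s≤s k≤b) = up k≤b r
  ... | inj₂ refl      = contradiction r ¬q

module LZ {A : Set} (_≟ᴬ_ : DecidableEquality A) where

  substring : List A → ℕ → ℕ → List A
  substring S p ℓ = take ℓ (drop p S)

  -- For nonempty F this forces p + length F ≤ length S.
  OccursAt : List A → List A → ℕ → Set
  OccursAt S F p = substring S p (length F) ≡ F

  OccursBefore : List A → List A → ℕ → Set
  OccursBefore S F b = ∃[ p ] p < b × OccursAt S F p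

  IsFactorization : List A → List (List A) → Set
  IsFactorization S Fs = All (_≢ []) Fs × concat Fs ≡ S

  start : (Fs : List (List A)) → Fin (length Fs) → ℕ
  start (F ∷ Fs) zero    = 0
  start (F ∷ Fs) (suc j) = length F + start Fs j

  record IsLongestPrevious (S : List A) (b : ℕ) (F : List A) : Set where
    field
      isPrefix : OccursAt S F b
      earlier  : OccursBefore S F b
      longest  : ∀ G → OccursAt S G b → OccursBefore S G b → length G ≤ length F

  -- substring S b 1 is the single character S[b].
  IsLZPhrase : List A → ℕ → List A → Set
  IsLZPhrase S b F =
      (¬ OccursBefore S (substring S b 1) b × F ≡ substring S b 1)
    ⊎ (OccursBefore S (substring S b 1) b × IsLongestPrevious S b F)

  IsLZ : List A → List (List A) → Set
  IsLZ S Fs = IsFactorization S Fs × (∀ j → IsLZPhrase S (start Fs j) (lookup Fs j))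

  IsLZLike : List A → List (List A) → Set
  IsLZLike S Fs = IsFactorization S Fs ×
    (∀ j → length (lookup Fs j) ≡ 1 ⊎ OccursBefore S (lookup Fs j) (start Fs j))

  -- The phrase of length ℓ starting at b contains the leftmost occurrence
  -- in S of some character.
  ContainsLeftmost : List A → ℕ → ℕ → Set
  ContainsLeftmost S b ℓ =
    ∃[ i ] i < b + ℓ × b ≤ i × ¬ OccursBefore S (substring S i 1) i

  -- nothing plays the role of ⊥.
  Sources : List (List A) → Set
  Sources Fs = ∀ j → Maybe (Fin (start Fs j))

  IsSource : List A → (b : ℕ) → List A → Maybe (Fin b) → Set
  IsSource S b F (just s) = OccursAt S F (toℕ s)
  IsSource S b F nothing  = ContainsLeftmost S b (length F)

  module _ (Fs : List (List A)) where

    InPhrase : ℕ → Fin (length Fs) → Set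
    InPhrase i j = start Fs j ≤ i × i < start Fs j + length (lookup Fs j)

    inPhrase? : ∀ i → Dec (∃ (InPhrase i))
    inPhrase? i = Fin.any? λ j → (start Fs j ≤? i) ×-dec (i <? start Fs j + length (lookup Fs j))

  follow : ∀ {b} → Maybe (Fin b) → ℕ → Maybe ℕ
  follow         nothing  i = nothing
  follow {b = b} (just s) i = just (toℕ s + (i ∸ b) % (b ∸ toℕ s))
    where instance _ = >-nonZero (m<n⇒0<n∸m (Fin.toℕ<n s))

  -- Positions outside the string, which never arise, are sent to nothing.
  τ : (Fs : List (List A)) → Sources Fs → Maybe ℕ → Maybe ℕ
  τ Fs source nothing  = nothing
  τ Fs source (just i) with inPhrase? Fs i
  ... | yes (j , _) = follow (source j) i
  ... | no _        = nothing

  VanishesAfter : (Fs : List (List A)) → Sources Fs → ℕ → ℕ → Set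
  VanishesAfter Fs source i k = fold (just i) (τ Fs source) (suc k) ≡ nothing

  follow-< : ∀ {b} (s : Maybe (Fin b)) i {k} → follow s i ≡ just k → k < b
  follow-< {b} (just s) i refl = begin-strict
      toℕ s + (i ∸ b) % (b ∸ toℕ s) <⟨ +-monoʳ-< (toℕ s) (m%n<n (i ∸ b) (b ∸ toℕ s)) ⟩
      toℕ s + (b ∸ toℕ s)           ≡⟨ m+[n∸m]≡n (<⇒≤ (Fin.toℕ<n s)) ⟩
      b                             ∎
    where
    open ≤-Reasoning
    instance _ = >-nonZero (m<n⇒0<n∸m (Fin.toℕ<n s))

  module _ (Fs : List (List A)) (source : Sources Fs) where

    τ-decreases : ∀ i {k} → τ Fs source (just i) ≡ just k → k < i
    τ-decreases i eq with inPhrase? Fs i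
    ... | yes (j , b≤i , _) = <-≤-trans (follow-< (source j) i eq) b≤i

    τ-iterates : ∀ i k → fold (just i) (τ Fs source) k ≡ nothing
                       ⊎ ∃[ j ] fold (just i) (τ Fs source) k ≡ just j × j + k ≤ i
    τ-iterates i zero    = inj₂ (i , refl , ≤-reflexive (+-identityʳ i))
    τ-iterates i (suc k) with fold (just i) (τ Fs source) k | τ-iterates i k
    ... | nothing | _ = inj₁ refl
    ... | just j  | inj₂ (_ , refl , j+k≤i) with τ Fs source (just j) in eq
    ...   | nothing = inj₁ refl
    ...   | just j′ = inj₂ (j′ , refl , (begin
            j′ + suc k ≡⟨ +-suc j′ k ⟩
            suc j′ + k ≤⟨ +-monoˡ-≤ k (τ-decreases j eq) ⟩
            j + k      ≤⟨ j+k≤i ⟩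
            i          ∎))
            where open ≤-Reasoning

    vanishes : ∀ i → ∃ (VanishesAfter Fs source i)
    vanishes i with τ-iterates i (suc i)
    ... | inj₁ eq             = i , eq
    ... | inj₂ (j , _ , j+i<i) = contradiction (≤-trans (m≤n+m (suc i) j) j+i<i) (<-irrefl refl)

    vanishesAfter? : ∀ i → Decidable (VanishesAfter Fs source i)
    vanishesAfter? i k with fold (just i) (τ Fs source) (suc k)
    ... | nothing = yes refl
    ... | just _  = no λ ()

    depth-exists : ∀ i → ∃ (IsLeast (VanishesAfter Fs source i))
    depth-exists i = least (vanishesAfter? i) (vanishes i)

    depth : ℕ → ℕ
    depth i = proj₁ (depth-exists i)

    heightOf : ℕ
    heightOf = max 0 (map depth (upTo (length (concat Fs))))

  -- The nothing-phrases are those containing the leftmost occurrence of a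
  -- character: isSource gives one direction, and a phrase with a source
  -- contains no leftmost occurrence.
  record Encoding (S : List A) : Set where
    field
      phrases  : List (List A)
      isLZLike : IsLZLike S phrases
      source   : Sources phrases
      isSource : ∀ j → IsSource S (start phrases j) (lookup phrases j) (source j)

    size : ℕ
    size = length phrases

    height : ℕ
    height = heightOf phrases source

  open Encoding public using (size; height)

  IsSizeWithin : ℕ → List A → ℕ → Set
  IsSizeWithin h S f = ∃ λ (E : Encoding S) → height E ≤ h × size E ≡ f

  _≟ˢ_ : DecidableEquality (List A)
  _≟ˢ_ = ≡-dec _≟ᴬ_

  occursAt? : ∀ S F → Decidable (OccursAt S F)
  occursAt? S F p = substring S p (length F) ≟ˢ F

  occursBefore? : ∀ S F → Decidable (OccursBefore S F)
  occursBefore? S F = anyUpTo? (occursAt? S F)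

  private
    take-all : ∀ (xs : List A) {ys} → take (length xs) (xs ++ ys) ≡ xs
    take-all []       = refl
    take-all (x ∷ xs) = cong (x ∷_) (take-all xs)

    drop-past : ∀ (xs : List A) k {ys} → drop (length xs + k) (xs ++ ys) ≡ drop k ys
    drop-past []       k = refl
    drop-past (x ∷ xs) k = drop-past xs k

  phrase-occurs : ∀ {S Fs} → IsFactorization S Fs → ∀ j → OccursAt S (lookup Fs j) (start Fs j)
  phrase-occurs {Fs = Fs} (_ , refl) = go Fs
    where
    go : ∀ Fs j → OccursAt (concat Fs) (lookup Fs j) (start Fs j)
    go (F ∷ Fs) zero    = take-all F
    go (F ∷ Fs) (suc j) =
      trans (cong (take (length (lookup Fs j))) (drop-past F (start Fs j))) (go Fs j)

  private
    length-substring : ∀ S b {ℓ} → ℓ ≤ length (drop b S) → length (substring S b ℓ) ≡ ℓ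
    length-substring S b {ℓ} ℓ≤ = trans (length-take ℓ (drop b S)) (m≤n⇒m⊓n≡m ℓ≤)

    substring-occurs : ∀ S b {ℓ} → ℓ ≤ length (drop b S) → OccursAt S (substring S b ℓ) b
    substring-occurs S b ℓ≤ = cong (substring S b) (length-substring S b ℓ≤)

    nonempty : ∀ {F : List A} → 1 ≤ length F → F ≢ []
    nonempty () refl

    nextPhrase : ∀ S b → 1 ≤ length (drop b S) →
                 ∃[ F ] 1 ≤ length F × OccursAt S F b × IsLZPhrase S b F
    nextPhrase S b 1≤ with occursBefore? S (substring S b 1) b
    ... | no ¬occ =
      substring S b 1 , ≤-reflexive (sym (length-substring S b 1≤)) , substring-occurs S b 1≤ ,
      inj₁ (¬occ , refl)
    ... | yes occ
        with greatest (λ ℓ → occursBefore? S (substring S b ℓ) b) (length (drop b S)) (1 , 1≤ , occ)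
    ...   | ℓ , ℓ≤ , occℓ , maximal =
      substring S b ℓ , subst (1 ≤_) (sym ∣F∣≡ℓ) (maximal 1≤ occ) , substring-occurs S b ℓ≤ ,
      inj₂ (occ , record
        { isPrefix = substring-occurs S b ℓ≤
        ; earlier  = occℓ
        ; longest  = λ G prefix before → subst (length G ≤_) (sym ∣F∣≡ℓ)
            (maximal (bound G prefix) (subst (λ F → OccursBefore S F b) (sym prefix) before))
        })
      where
      ∣F∣≡ℓ : length (substring S b ℓ) ≡ ℓ
      ∣F∣≡ℓ = length-substring S b ℓ≤
      bound : ∀ G → OccursAt S G b → length G ≤ length (drop b S)
      bound G prefix = m⊓n≡m⇒m≤n (trans (sym (length-take (length G) (drop b S))) (cong length prefix))

    lzFrom : ∀ S n b → length (drop b S) ≤ n →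
             ∃[ Fs ] All (_≢ []) Fs × concat Fs ≡ drop b S ×
                     (∀ j → IsLZPhrase S (b + start Fs j) (lookup Fs j))
    lzFrom S n b ≤n with drop b S in eq
    lzFrom S n       b ≤n       | [] = [] , [] , refl , λ ()
    lzFrom S (suc n) b (s≤s ≤n) | x ∷ xs
      with nextPhrase S b (subst (λ T → 1 ≤ length T) (sym eq) (s≤s z≤n))
    ... | F@(y ∷ F′) , 1≤F , occ , isLZ with lzFrom S n (b + length F) (shorter y F′)
      where
      shorter : ∀ y (G : List A) → length (drop (b + length (y ∷ G)) S) ≤ n
      shorter y G = begin
        length (drop (b + length (y ∷ G)) S)   ≡⟨ cong length (sym (drop-drop b (length (y ∷ G)) S)) ⟩
        length (drop (length (y ∷ G)) (drop b S)) ≡⟨ cong (length ∘ drop (length (y ∷ G))) eq ⟩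
        length (drop (length G) xs)            ≡⟨ length-drop (length G) xs ⟩
        length xs ∸ length G                   ≤⟨ m∸n≤m (length xs) (length G) ⟩
        length xs                              ≤⟨ ≤n ⟩
        n                                      ∎
        where open ≤-Reasoning
    ...   | Fs , nonempties , concat≡ , areLZ =
      F ∷ Fs , (λ ()) ∷ nonempties , concat≡′ , areLZ′
      where
      concat≡′ : F ++ concat Fs ≡ x ∷ xs
      concat≡′ = begin
        F ++ concat Fs                                   ≡⟨ cong (F ++_) concat≡ ⟩
        F ++ drop (b + length F) S                       ≡⟨ cong (F ++_) (sym (drop-drop b (length F) S)) ⟩
        F ++ drop (length F) (drop b S)                  ≡⟨ cong (_++ drop (length F) (drop b S)) (sym occ) ⟩
        substring S b (length F) ++ drop (length F) (drop b S) ≡⟨ take++drop≡id (length F) (drop b S) ⟩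
        drop b S                                         ≡⟨ eq ⟩
        x ∷ xs                                           ∎
        where open ≡-Reasoning
      areLZ′ : ∀ j → IsLZPhrase S (b + start (F ∷ Fs) j) (lookup (F ∷ Fs) j)
      areLZ′ zero    = subst (λ i → IsLZPhrase S i F) (sym (+-identityʳ b)) isLZ
      areLZ′ (suc j) = subst (λ i → IsLZPhrase S i (lookup Fs j)) (+-assoc b (length F) (start Fs j)) (areLZ j)

  lz-exists : ∀ S → ∃ (IsLZ S)
  lz-exists S with lzFrom S (length S) 0 ≤-refl
  ... | Fs , nonempties , concat≡ , areLZ = Fs , (nonempties , concat≡) , areLZ

  z : List A → ℕ
  z S = length (proj₁ (lz-exists S))

  private
    growFirst : A → List (List A) → List (List (List A))
    growFirst c Fs@(F ∷ Gs) = ([ c ] ∷ Fs) ∷ ((c ∷ F) ∷ Gs) ∷ []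
    growFirst c []          = ([ c ] ∷ []) ∷ []

    factorizations : List A → List (List (List A))
    factorizations []      = [ [] ]
    factorizations (c ∷ S) = concatMap (growFirst c) (factorizations S)

    startsNew : ∀ c Fs → ([ c ] ∷ Fs) ∈ growFirst c Fs
    startsNew c []       = here refl
    startsNew c (F ∷ Fs) = here refl

    factorizations-complete : ∀ {S Fs} → IsFactorization S Fs → Fs ∈ factorizations S
    factorizations-complete {[]} {[]}          _ = here refl
    factorizations-complete {[]} {[] ∷ Fs}     (F≢[] ∷ _ , _) = contradiction refl F≢[]
    factorizations-complete {c ∷ S} {[] ∷ Fs}  (F≢[] ∷ _ , _) = contradiction refl F≢[]
    factorizations-complete {c ∷ S} {(_ ∷ []) ∷ Fs} (_ ∷ ne , refl) =
      ∈-concatMap⁺ (growFirst c) (lose (factorizations-complete (ne , refl)) (startsNew c Fs))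
    factorizations-complete {c ∷ S} {(_ ∷ F@(_ ∷ _)) ∷ Fs} (_ ∷ ne , refl) =
      ∈-concatMap⁺ (growFirst c) (lose (factorizations-complete {Fs = F ∷ Fs} ((λ ()) ∷ ne , refl)) (there (here refl)))

    searchMaybe : ∀ {b} {P : Maybe (Fin b) → Set} → Decidable P → Dec (∃ P)
    searchMaybe {b} {P} P? = map′ to from (P? nothing ⊎-dec Fin.any? (P? ∘ just))
      where
      to : P nothing ⊎ ∃ (P ∘ just) → ∃ P
      to (inj₁ p)       = nothing , p
      to (inj₂ (s , p)) = just s , p
      from : ∃ P → P nothing ⊎ ∃ (P ∘ just)
      from (nothing , p) = inj₁ p
      from (just s  , p) = inj₂ (s , p)

    searchΠ : ∀ {n} {b : Fin n → ℕ} {P : (∀ j → Maybe (Fin (b j))) → Set} →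
              (∀ {f g} → (∀ j → f j ≡ g j) → P f → P g) → Decidable P → Dec (∃ P)
    searchΠ {zero} {b} resp P? =
      map′ (empty ,_) (λ (f , p) → resp {f} {empty} (λ ()) p) (P? empty)
      where
      empty : ∀ j → Maybe (Fin (b j))
      empty ()
    searchΠ {suc n} {b} {P} resp P? =
      map′ (λ (x , f , p) → cons x f , p)
           (λ (f , p) → f zero , f ∘ suc , resp (λ { zero → refl ; (suc j) → refl }) p)
           (searchMaybe λ x → searchΠ (λ f≗g → resp λ { zero → refl ; (suc j) → f≗g j }) (P? ∘ cons x))
      where
      cons : Maybe (Fin (b zero)) → (∀ j → Maybe (Fin (b (suc j)))) → ∀ j → Maybe (Fin (b j))
      cons x f zero    = x
      cons x f (suc j) = f j

  module _ {Fs : List (List A)} {s t : Sources Fs} (s≗t : ∀ j → s j ≡ t j) where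

    τ-cong : ∀ m → τ Fs s m ≡ τ Fs t m
    τ-cong nothing  = refl
    τ-cong (just i) with inPhrase? Fs i
    ... | yes (j , _) = cong (λ x → follow x i) (s≗t j)
    ... | no _        = refl

    iterate-cong : ∀ i k → fold (just i) (τ Fs s) k ≡ fold (just i) (τ Fs t) k
    iterate-cong i zero    = refl
    iterate-cong i (suc k) = trans (cong (τ Fs s) (iterate-cong i k)) (τ-cong (fold (just i) (τ Fs t) k))

    depth-cong : ∀ i → depth Fs s i ≡ depth Fs t i
    depth-cong i with depth-exists Fs s i | depth-exists Fs t i
    ... | m , sm , m≤ | n , tn , n≤ =
      ≤-antisym (m≤ (trans (iterate-cong i (suc n)) tn))
                (n≤ (trans (sym (iterate-cong i (suc m))) sm))

    heightOf-cong : heightOf Fs s ≡ heightOf Fs t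
    heightOf-cong = cong (max 0) (map-cong depth-cong (upTo (length (concat Fs))))

  private
    isFactorization? : ∀ S Fs → Dec (IsFactorization S Fs)
    isFactorization? S Fs = All.all? (λ F → ¬? (F ≟ˢ [])) Fs ×-dec (concat Fs ≟ˢ S)

    isLZLike? : ∀ S Fs → Dec (IsLZLike S Fs)
    isLZLike? S Fs = isFactorization? S Fs ×-dec
      Fin.all? (λ j → (length (lookup Fs j) ≟ 1) ⊎-dec occursBefore? S (lookup Fs j) (start Fs j))

    isSource? : ∀ S b F → Decidable (IsSource S b F)
    isSource? S b F (just s) = occursAt? S F (toℕ s)
    isSource? S b F nothing  =
      anyUpTo? (λ i → (b ≤? i) ×-dec ¬? (occursBefore? S (substring S i 1) i)) (b + length F)

    SourcesWithin : ℕ → List A → (Fs : List (List A)) → Sources Fs → Set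
    SourcesWithin h S Fs source =
      (∀ j → IsSource S (start Fs j) (lookup Fs j) (source j)) × heightOf Fs source ≤ h

    sourcesWithin? : ∀ h S Fs → Dec (∃ (SourcesWithin h S Fs))
    sourcesWithin? h S Fs = searchΠ resp λ source →
      Fin.all? (λ j → isSource? S (start Fs j) (lookup Fs j) (source j)) ×-dec (heightOf Fs source ≤? h)
      where
      resp : ∀ {s t} → (∀ j → s j ≡ t j) → SourcesWithin h S Fs s → SourcesWithin h S Fs t
      resp {s} {t} s≗t (valid , ≤h) =
        (λ j → subst (IsSource S (start Fs j) (lookup Fs j)) (s≗t j) (valid j)) ,
        subst (_≤ h) (heightOf-cong {Fs} {s} {t} s≗t) ≤h

  isSizeWithin? : ∀ h S → Decidable (IsSizeWithin h S)
  isSizeWithin? h S f = map′ to from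
    (Any.any? (λ Fs → isLZLike? S Fs ×-dec (length Fs ≟ f) ×-dec sourcesWithin? h S Fs) (factorizations S))
    where
    Good : List (List A) → Set
    Good Fs = IsLZLike S Fs × length Fs ≡ f × ∃ (SourcesWithin h S Fs)
    to : Any.Any Good (factorizations S) → IsSizeWithin h S f
    to any with find any
    ... | Fs , _ , like , size≡ , source , valid , ≤h =
      record { phrases = Fs ; isLZLike = like ; source = source ; isSource = valid } , ≤h , size≡
    from : IsSizeWithin h S f → Any.Any Good (factorizations S)
    from (E , ≤h , size≡) =
      lose (factorizations-complete (proj₁ isLZLike)) (isLZLike , size≡ , source , isSource , ≤h)
      where open Encoding E

  -- Witness for ẑ-exists: every phrase is a single character that refers to
  -- its leftmost occurrence, so the height is at most 1.
  private module Singletons (S : List A) where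

    Fs : List (List A)
    Fs = map [_] S

    isFactorization : IsFactorization S Fs
    isFactorization = go S
      where
      go : ∀ S → IsFactorization S (map [_] S)
      go []      = [] , refl
      go (c ∷ S) with go S
      ... | ne , eq = (λ ()) ∷ ne , cong (c ∷_) eq

    length≡1 : ∀ j → length (lookup Fs j) ≡ 1
    length≡1 = go S
      where
      go : ∀ S j → length (lookup (map [_] S) j) ≡ 1
      go (c ∷ S) zero    = refl
      go (c ∷ S) (suc j) = go S j

    character : ∀ j → substring S (start Fs j) 1 ≡ lookup Fs j
    character j = subst (λ ℓ → substring S (start Fs j) ℓ ≡ lookup Fs j) (length≡1 j)
                        (phrase-occurs isFactorization j)

    IsFirst : ∀ {b} → List A → Maybe (Fin b) → Set
    IsFirst {b} F nothing  = ¬ OccursBefore S F b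
    IsFirst     F (just s) = OccursAt S F (toℕ s) × ¬ OccursBefore S F (toℕ s)

    first : ∀ F b → ∃ (IsFirst {b} F)
    first F b with occursBefore? S F b
    ... | no ¬occ = nothing , ¬occ
    ... | yes (p , p<b , occ) with least (occursAt? S F) (p , occ)
    ...   | q , occ-q , q≤ =
      just (fromℕ< q<b) ,
      subst (λ i → OccursAt S F i × ¬ OccursBefore S F i) (sym (Fin.toℕ-fromℕ< q<b))
            (occ-q , λ (r , r<q , occ-r) → <⇒≱ r<q (q≤ occ-r))
      where
      q<b : q < b
      q<b = ≤-<-trans (q≤ occ) p<b

    source : Sources Fs
    source j = proj₁ (first (lookup Fs j) (start Fs j))

    source-first : ∀ j → IsFirst (lookup Fs j) (source j)
    source-first j = proj₂ (first (lookup Fs j) (start Fs j))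

    atStart : ∀ {i} j → InPhrase Fs i j → i ≡ start Fs j
    atStart {i} j (b≤i , i<) = ≤-antisym (s≤s⁻¹ i<1+b) b≤i
      where
      i<1+b : i < suc (start Fs j)
      i<1+b = subst (i <_) (trans (cong (start Fs j +_) (length≡1 j)) (+-comm (start Fs j) 1)) i<

    LeftmostAt : ℕ → Set
    LeftmostAt k = ¬ OccursBefore S (substring S k 1) k

    isSource : ∀ j → IsSource S (start Fs j) (lookup Fs j) (source j)
    isSource j with source j | source-first j
    ... | just s  | occ , _ = occ
    ... | nothing | ¬occ    =
      start Fs j , m<m+n (start Fs j) (subst (0 <_) (sym (length≡1 j)) z<s) , ≤-refl ,
      subst (λ F → ¬ OccursBefore S F (start Fs j)) (sym (character j)) ¬occ

    τ-leftmost : ∀ {k} → LeftmostAt k → τ Fs source (just k) ≡ nothing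
    τ-leftmost {k} leftmost with inPhrase? Fs k
    ... | no _ = refl
    ... | yes (j , in-j) with source j | source-first j
    ...   | nothing | _       = refl
    ...   | just s  | occ , _ with refl ← atStart j in-j =
      contradiction (toℕ s , Fin.toℕ<n s , subst (λ F → OccursAt S F (toℕ s)) (sym (character j)) occ) leftmost

    follow-start : ∀ {b} (s : Fin b) → follow (just s) b ≡ just (toℕ s)
    follow-start {b} s = cong just (begin
        toℕ s + (b ∸ b) % (b ∸ toℕ s) ≡⟨ cong (λ r → toℕ s + r % (b ∸ toℕ s)) (n∸n≡0 b) ⟩
        toℕ s + 0 % (b ∸ toℕ s)       ≡⟨ cong (toℕ s +_) (m<n⇒m%n≡m (m<n⇒0<n∸m (Fin.toℕ<n s))) ⟩
        toℕ s + 0                     ≡⟨ +-identityʳ (toℕ s) ⟩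
        toℕ s                         ∎)
      where
      open ≡-Reasoning
      instance _ = >-nonZero (m<n⇒0<n∸m (Fin.toℕ<n s))

    ττ : ∀ i → τ Fs source (τ Fs source (just i)) ≡ nothing
    ττ i with inPhrase? Fs i
    ... | no _ = refl
    ... | yes (j , in-j) with source j | source-first j
    ...   | nothing | _              = refl
    ...   | just s  | occ , ¬earlier with refl ← atStart j in-j =
      trans (cong (τ Fs source) (follow-start s))
            (τ-leftmost (subst (λ F → ¬ OccursBefore S F (toℕ s)) (sym at-s) ¬earlier))
      where
      at-s : substring S (toℕ s) 1 ≡ lookup Fs j
      at-s = subst (λ ℓ → substring S (toℕ s) ℓ ≡ lookup Fs j) (length≡1 j) occ

    height≤1 : heightOf Fs source ≤ 1
    height≤1 = max≤v⁺ z≤n (All.map⁺ (All.universal depth≤1 (upTo (length (concat Fs)))))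
      where
      depth≤1 : ∀ i → depth Fs source i ≤ 1
      depth≤1 i = proj₂ (proj₂ (depth-exists Fs source i)) (ττ i)

    encoding : Encoding S
    encoding = record
      { phrases = Fs ; isLZLike = isFactorization , inj₁ ∘ length≡1 ; source = source ; isSource = isSource }

  ẑ-exists : ∀ h .⦃ _ : NonZero h ⦄ S → ∃ (IsLeast (IsSizeWithin h S))
  ẑ-exists h S = least (isSizeWithin? h S)
    (_ , Singletons.encoding S , ≤-trans (Singletons.height≤1 S) (>-nonZero⁻¹ h) , refl)

  ẑ : ∀ h .⦃ _ : NonZero h ⦄ → List A → ℕ
  ẑ h S = proj₁ (ẑ-exists h S)

-- finToFun and funToFin convert between x < 2 ^ k and its k binary digits,
-- most significant first.
bitReversal : ∀ k → Fin (2 ^ k) → Fin (2 ^ k)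
bitReversal k x = funToFin (finToFun {2} {k} x ∘ opposite)

data Letter : Set where
  𝚊 : ℕ → Letter
  𝚋 : Letter
  $ : ℕ → Letter

_≟ᴸ_ : DecidableEquality Letter
𝚊 i ≟ᴸ 𝚊 j = map′ (cong 𝚊) (λ { refl → refl }) (i ≟ j)
𝚊 _ ≟ᴸ 𝚋   = no λ ()
𝚊 _ ≟ᴸ $ _ = no λ ()
𝚋   ≟ᴸ 𝚊 _ = no λ ()
𝚋   ≟ᴸ 𝚋   = yes refl
𝚋   ≟ᴸ $ _ = no λ ()
$ _ ≟ᴸ 𝚊 _ = no λ ()
$ _ ≟ᴸ 𝚋   = no λ ()
$ x ≟ᴸ $ y = map′ (cong $) (λ { refl → refl }) (x ≟ y)

open LZ _≟ᴸ_ public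

R[_,_]at : ∀ α → ℕ → Fin (2 ^ α) → Letter
R[ α , x ]at i = if toℕ (bitReversal α i) <ᵇ x then 𝚊 (toℕ i) else 𝚋

R : ℕ → ℕ → List Letter
R α x = tabulate R[ α , x ]at ∷ʳ $ x

S : ℕ → List Letter
S α = concat (applyUpTo (R α ∘ suc) (2 ^ α ∸ 1))

n : ℕ → ℕ
n α = length (S α)

n≡m²∸1 : ∀ α → n α ≡ (2 ^ α) ^ 2 ∸ 1
n≡m²∸1 α = trans (length-blocks (R α ∘ suc) (2 ^ α ∸ 1) (λ x → length-R (suc x))) (arith (2 ^ α) ⦃ m^n≢0 2 α ⦄)
  where
  length-R : ∀ x → length (R α x) ≡ 2 ^ α + 1
  length-R x = trans (length-++ (tabulate R[ α , x ]at)) (cong (_+ 1) (length-tabulate R[ α , x ]at))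

  length-blocks : ∀ {ℓ} (f : ℕ → List Letter) k → (∀ x → length (f x) ≡ ℓ) →
                  length (concat (applyUpTo f k)) ≡ k * ℓ
  length-blocks f zero    _  = refl
  length-blocks f (suc k) eq =
    trans (length-++ (f 0)) (cong₂ _+_ (eq 0) (length-blocks (f ∘ suc) k (eq ∘ suc)))

  arith : ∀ m ⦃ _ : NonZero m ⦄ → (m ∸ 1) * (m + 1) ≡ m ^ 2 ∸ 1
  arith (suc k) = trans (cong (k *_) (cong suc (+-comm k 1))) (rearrange k)
    where
    rearrange : ∀ k → k * suc (suc k) ≡ k * 1 + k * (suc k * 1)
    rearrange k = trans (cong (k *_) (cong suc (cong suc (sym (*-identityʳ k))))) (*-distribˡ-+ k 1 (suc k * 1))

-- Asymptotic notation concerns sequences indexed by α ≥ 3, as α → ∞; this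
-- is n → ∞ along the lengths of the strings, n being increasing in α.
Eventually : (ℕ → Set) → Set
Eventually P = ∃[ N ] ∀ α → 3 ≤ α → N ≤ α → P α

infix 4 _∈O_ _/_∈Ω_/_

_∈O_ : (ℕ → ℕ) → (ℕ → ℕ) → Set
f ∈O g = ∃[ C ] Eventually λ α → f α ≤ C * g α

-- For eventually positive g and q this is f/g ≥ (1/C) · p/q with the
-- denominators cleared.
_/_∈Ω_/_ : (f g p q : ℕ → ℕ) → Set
f / g ∈Ω p / q = ∃[ C ] Eventually λ α → p α * g α ≤ C * (f α * q α)

-- Rounding the logarithms down changes the sequences below by at most a
-- constant factor, since n ≥ 63 and hence log log n ≥ 2.
log[n] loglog[n] : ℕ → ℕ
log[n]    α = ⌊log₂ n α ⌋
loglog[n] α = ⌊log₂ log[n] α ⌋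

_∈O[polylog-n] : (ℕ → ℕ) → Set
f ∈O[polylog-n] = ∃[ k ] f ∈O λ α → log[n] α ^ k

-- f ≥ n ^ ε for some ε > 0; as n ≥ 1, ε may be taken to be 1/d.
_∈n^Ω[1] : (ℕ → ℕ) → Set
f ∈n^Ω[1] = ∃[ d ] Eventually λ α → n α ≤ f α ^ d

{-# OPTIONS --safe #-}
-- Write m = 2 ^ α. Column i of block R x holds 𝚊 i iff rev α i < x, so a
-- position that differs from the one a block above it is a $, or the first
-- occurrence of some 𝚊 i. There are O(m) of them, and an LZ phrase always
-- reaches the position before the next one; hence z = O(m).
--
-- In an encoding, a phrase containing a letter 𝚊 i lies inside one block and
-- is copied from the same columns of the block d rows above, for some d > 0;
-- it then avoids the columns on which rev takes one of d consecutive values,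
-- so it has O(m / d) columns. Following 𝚊 i from r blocks below its first
-- occurrence back to it takes at most h steps, so jumps d with δ ≤ d < r,
-- where 4 h δ ≤ r, make up a constant fraction of the way. A phrase with such
-- a jump d is used by O(r / d) columns i, as their values of rev lie in a
-- window of length r; it thus accounts for O(r) of the total distance Ω(m r).
-- So there are Ω(m) phrases with jump in [δ , r), for each of the
-- Ω(log m / log h) disjoint scales [H ^ s , H ^ (s + 1)) with H ≥ 4 h.

module Submission where

open import Defs
open import Data.Bool using (if_then_else_)
open import Data.Fin using (Fin; zero; suc; toℕ; fromℕ; fromℕ<; inject₁; opposite; finToFun; funToFin)
import Data.Fin.Properties as Fin
open import Data.List using (List; []; _∷_; _++_; [_]; length; concat; take; drop; head; lookup; tabulate; applyUpTo)
open import Data.List.Extrema.Nat using (xs≤max)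
open import Data.List.Membership.Propositional.Properties using (∈-lookup; ∈-map⁺; ∈-upTo⁺)
open import Data.List.Properties using (length-++; length-take; length-drop; length-tabulate; drop-drop)
open import Data.List.Relation.Unary.All as All using (All)
open import Data.Maybe using (Maybe; just; nothing; maybe′)
open import Data.Maybe.Properties using (just-injective; ≡-dec)
open import Data.Nat
open import Data.Nat.DivMod
open import Data.Nat.Divisibility using (n∣m*n)
open import Data.Nat.GeneralisedArithmetic using (fold)
open import Data.Nat.Induction using (<-rec)
open import Data.Nat.Logarithm using (⌊log₂_⌋; ⌊log₂⌋-mono-≤; ⌊log₂[2^n]⌋≡n)
open import Data.Nat.Properties
open import Data.Nat.Tactic.RingSolver using (solve-∀)
open import Data.Product using (∃; ∃-syntax; _×_; _,_; proj₁; proj₂)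
open import Data.Sum using (inj₁; inj₂)
open import Function using (_∘_)
open import Relation.Binary using (tri<; tri≈; tri>)
open import Relation.Binary.PropositionalEquality hiding ([_])
open import Relation.Nullary using (¬_; Dec; yes; no; does; contradiction)
open import Relation.Nullary.Decidable using (_×-dec_; ¬?; dec-true; dec-false; decidable-stable)

-- Division with remainder and powers of two.

[q*n+r]/n≡q : ∀ q {n r} .⦃ _ : NonZero n ⦄ → r < n → (q * n + r) / n ≡ q
[q*n+r]/n≡q q {n} {r} r<n = begin
  (q * n + r) / n   ≡⟨ +-distrib-/-∣ˡ r (n∣m*n q) ⟩
  q * n / n + r / n ≡⟨ cong₂ _+_ (m*n/n≡m q n) (m<n⇒m/n≡0 r<n) ⟩
  q + 0             ≡⟨ +-identityʳ q ⟩
  q                 ∎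
  where open ≡-Reasoning

[q*n+r]%n≡r : ∀ q {n r} .⦃ _ : NonZero n ⦄ → r < n → (q * n + r) % n ≡ r
[q*n+r]%n≡r q {n} {r} r<n = trans (%-remove-+ˡ r (n∣m*n q)) (m<n⇒m%n≡m r<n)

q*n+r≡m : ∀ m n .⦃ _ : NonZero n ⦄ → m / n * n + m % n ≡ m
q*n+r≡m m n = trans (+-comm (m / n * n) (m % n)) (sym (m≡m%n+[m/n]*n m n))

q*n+r-injective : ∀ {q q′ n r r′} → r < n → r′ < n → q * n + r ≡ q′ * n + r′ → q ≡ q′ × r ≡ r′
q*n+r-injective {q} {q′} {n} r<n r′<n eq =
  trans (sym ([q*n+r]/n≡q q r<n)) (trans (cong (_/ n) eq) ([q*n+r]/n≡q q′ r′<n)) ,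
  trans (sym ([q*n+r]%n≡r q r<n)) (trans (cong (_% n) eq) ([q*n+r]%n≡r q′ r′<n))
  where instance _ = >-nonZero (≤-<-trans z≤n r<n)

2^-bracket : ∀ k → ∃[ e ] 2 ^ e ≤ suc k × suc k < 2 ^ suc e
2^-bracket zero = 0 , ≤-refl , ≤-refl
2^-bracket (suc k) with 2^-bracket k
... | e , 2^e≤ , <2^ with suc (suc k) <? 2 ^ suc e
...   | yes <2^′ = e , m≤n⇒m≤1+n 2^e≤ , <2^′
...   | no ≮2^   = suc e , ≮⇒≥ ≮2^ , ≤-<-trans <2^ (^-monoʳ-< 2 (s≤s (s≤s z≤n)) (n<1+n (suc e)))

-- Bit reversal.

rev : ℕ → ℕ → ℕ
rev zero    x = 0
rev (suc a) x = x % 2 * 2 ^ a + rev a (x / 2)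

private
  2^suc : ∀ a → 2 ^ suc a ≡ 2 ^ a + 2 ^ a
  2^suc a = cong (2 ^ a +_) (+-identityʳ (2 ^ a))

rev<2^ : ∀ a x → rev a x < 2 ^ a
rev<2^ zero    x = s≤s z≤n
rev<2^ (suc a) x = begin-strict
  x % 2 * 2 ^ a + rev a (x / 2) <⟨ +-mono-≤-< (*-monoˡ-≤ (2 ^ a) (s≤s⁻¹ (m%n<n x 2))) (rev<2^ a (x / 2)) ⟩
  1 * 2 ^ a + 2 ^ a             ≡⟨ cong (_+ 2 ^ a) (*-identityˡ (2 ^ a)) ⟩
  2 ^ a + 2 ^ a                 ≡⟨ 2^suc a ⟨
  2 ^ suc a                     ∎
  where open ≤-Reasoning

rev-even : ∀ a u → rev (suc a) (u * 2) ≡ rev a u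
rev-even a u = cong₂ (λ e v → e * 2 ^ a + rev a v) (m*n%n≡0 u 2) (m*n/n≡m u 2)

-- The leading `a` digits of the reversal are the last `a` digits of `x`, reversed. Hence an aligned
-- interval of `2 ^ k` values of `rev (a + k)` corresponds to a residue class of columns modulo
-- `2 ^ a`.
rev-/ : ∀ a k x .⦃ _ : NonZero (2 ^ k) ⦄ → rev (a + k) x / 2 ^ k ≡ rev a x
rev-/ zero    k x = m<n⇒m/n≡0 (rev<2^ k x)
rev-/ (suc a) k x = begin
  (x % 2 * 2 ^ (a + k) + r) / 2 ^ k                 ≡⟨ cong (λ p → (x % 2 * p + r) / 2 ^ k) (^-distribˡ-+-* 2 a k) ⟩
  (x % 2 * (2 ^ a * 2 ^ k) + r) / 2 ^ k             ≡⟨ cong (λ p → (p + r) / 2 ^ k) (*-assoc (x % 2) (2 ^ a) (2 ^ k)) ⟨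
  (x % 2 * 2 ^ a * 2 ^ k + r) / 2 ^ k               ≡⟨ +-distrib-/-∣ˡ r (n∣m*n (x % 2 * 2 ^ a)) ⟩
  x % 2 * 2 ^ a * 2 ^ k / 2 ^ k + r / 2 ^ k         ≡⟨ cong₂ _+_ (m*n/n≡m (x % 2 * 2 ^ a) (2 ^ k)) (rev-/ a k (x / 2)) ⟩
  x % 2 * 2 ^ a + rev a (x / 2)                     ∎
  where
  open ≡-Reasoning
  r = rev (a + k) (x / 2)

-- `rev a` depends only on the lowest `a` digits, so the window may start anywhere. The leading
-- digit of `v` fixes the parity of `i`; halving leaves a window of half the length, starting at
-- `c / 2` rounded up for even `i` and rounded down for odd `i`.
rev-surjective : ∀ a {v} → v < 2 ^ a → ∀ c → ∃[ i ] c ≤ i × i < c + 2 ^ a × rev a i ≡ v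
rev-surjective zero    {zero} _ c = c , ≤-refl , ≤-reflexive (+-comm 1 c) , refl
rev-surjective zero    {suc _} (s≤s ()) c
rev-surjective (suc a) {v} v< c with v <? 2 ^ a
... | yes v<′ with rev-surjective a v<′ (suc c / 2)
...   | i , c′≤i , i< , rev≡ = i * 2 , s≤s⁻¹ c<1+i , i<′ , trans (rev-even a i) rev≡
  where
  open ≤-Reasoning
  c<1+i : suc c ≤ suc (i * 2)
  c<1+i = begin
    suc c                         ≡⟨ m≡m%n+[m/n]*n (suc c) 2 ⟩
    suc c % 2 + suc c / 2 * 2     ≤⟨ +-mono-≤ (s≤s⁻¹ (m%n<n (suc c) 2)) (*-monoˡ-≤ 2 c′≤i) ⟩
    suc (i * 2)                   ∎
  i<′ : i * 2 < c + 2 ^ suc a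
  i<′ = s≤s⁻¹ (begin
    suc i * 2                     ≤⟨ *-monoˡ-≤ 2 i< ⟩
    (suc c / 2 + 2 ^ a) * 2       ≡⟨ rearrange (suc c / 2) (2 ^ a) ⟩
    suc c / 2 * 2 + 2 ^ suc a     ≤⟨ +-monoˡ-≤ (2 ^ suc a) (m/n*n≤m (suc c) 2) ⟩
    suc c + 2 ^ suc a             ∎)
    where
    rearrange : ∀ x y → (x + y) * 2 ≡ x * 2 + 2 * y
    rearrange = solve-∀
rev-surjective (suc a) {v} v< c | no v≮ with rev-surjective a v′< (c / 2)
  where
  v′< : v ∸ 2 ^ a < 2 ^ a
  v′< = +-cancelʳ-< (2 ^ a) (v ∸ 2 ^ a) (2 ^ a)
          (subst₂ _<_ (sym (m∸n+n≡m (≮⇒≥ v≮))) (2^suc a) v<)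
...   | i , c′≤i , i< , rev≡ = i * 2 + 1 , c≤i , i<′ , rev≡′
  where
  open ≤-Reasoning
  c≤i : c ≤ i * 2 + 1
  c≤i = begin
    c                         ≡⟨ q*n+r≡m c 2 ⟨
    c / 2 * 2 + c % 2         ≤⟨ +-mono-≤ (*-monoˡ-≤ 2 c′≤i) (s≤s⁻¹ (m%n<n c 2)) ⟩
    i * 2 + 1                 ∎
  i<′ : i * 2 + 1 < c + 2 ^ suc a
  i<′ = begin
    suc (i * 2 + 1)           ≡⟨ cong suc (+-comm (i * 2) 1) ⟩
    suc i * 2                 ≤⟨ *-monoˡ-≤ 2 i< ⟩
    (c / 2 + 2 ^ a) * 2       ≡⟨ rearrange (c / 2) (2 ^ a) ⟩
    c / 2 * 2 + 2 ^ suc a     ≤⟨ +-monoˡ-≤ (2 ^ suc a) (m/n*n≤m c 2) ⟩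
    c + 2 ^ suc a             ∎
    where
    rearrange : ∀ x y → (x + y) * 2 ≡ x * 2 + 2 * y
    rearrange = solve-∀
  rev≡′ : rev (suc a) (i * 2 + 1) ≡ v
  rev≡′ = begin-equality
    rev (suc a) (i * 2 + 1) ≡⟨ cong₂ (λ e w → e * 2 ^ a + rev a w) ([q*n+r]%n≡r i {2} (s≤s (s≤s z≤n))) ([q*n+r]/n≡q i {2} (s≤s (s≤s z≤n))) ⟩
    1 * 2 ^ a + rev a i     ≡⟨ cong₂ _+_ (*-identityˡ (2 ^ a)) rev≡ ⟩
    2 ^ a + (v ∸ 2 ^ a)     ≡⟨ m+[n∸m]≡n (≮⇒≥ v≮) ⟩
    v                       ∎

private
  -- Equal reversals share their leading digit, so `i` and `j` have the same parity and their halves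
  -- lie in a window of half the length.
  rev-injective-≤ : ∀ a {i j} → i ≤ j → j < i + 2 ^ a → rev a i ≡ rev a j → i ≡ j
  rev-injective-≤ zero    {i} {j} i≤j j< _ = ≤-antisym i≤j (s≤s⁻¹ (subst (j <_) (+-comm i 1) j<))
  rev-injective-≤ (suc a) {i} {j} i≤j j< eq
    with q*n+r-injective (rev<2^ a (i / 2)) (rev<2^ a (j / 2)) eq
  ... | bit≡ , rev≡ = begin-equality
    i                 ≡⟨ m≡m%n+[m/n]*n i 2 ⟩
    i % 2 + i / 2 * 2 ≡⟨ cong₂ (λ e q → e + q * 2) bit≡ (rev-injective-≤ a (/-monoˡ-≤ 2 i≤j) j/2< rev≡) ⟩
    j % 2 + j / 2 * 2 ≡⟨ m≡m%n+[m/n]*n j 2 ⟨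
    j                 ∎
    where
    open ≤-Reasoning
    j/2< : j / 2 < i / 2 + 2 ^ a
    j/2< = *-cancelʳ-< 2 (j / 2) (i / 2 + 2 ^ a) (+-cancelˡ-< (j % 2) _ _ (begin-strict
      j % 2 + j / 2 * 2               ≡⟨ m≡m%n+[m/n]*n j 2 ⟨
      j                               <⟨ j< ⟩
      i + 2 ^ suc a                   ≡⟨ cong (_+ 2 ^ suc a) (m≡m%n+[m/n]*n i 2) ⟩
      i % 2 + i / 2 * 2 + 2 ^ suc a   ≡⟨ cong (λ e → e + i / 2 * 2 + 2 ^ suc a) bit≡ ⟩
      j % 2 + i / 2 * 2 + 2 ^ suc a   ≡⟨ rearrange (j % 2) (i / 2) (2 ^ a) ⟩
      j % 2 + (i / 2 + 2 ^ a) * 2     ∎))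
      where
      rearrange : ∀ e x y → e + x * 2 + 2 * y ≡ e + (x + y) * 2
      rearrange = solve-∀

rev-injective : ∀ a {i j} → i < j + 2 ^ a → j < i + 2 ^ a → rev a i ≡ rev a j → i ≡ j
rev-injective a {i} {j} i< j< eq with ≤-total i j
... | inj₁ i≤j = rev-injective-≤ a i≤j j< eq
... | inj₂ j≤i = sym (rev-injective-≤ a j≤i i< (sym eq))

private
  fromDigits : ∀ {a} → (Fin a → Fin 2) → ℕ
  fromDigits f = toℕ (funToFin f)

  fromDigits-suc : ∀ {a} (f : Fin (suc a) → Fin 2) →
                   fromDigits f ≡ 2 ^ a * toℕ (f zero) + fromDigits (f ∘ suc)
  fromDigits-suc f = Fin.toℕ-combine (f zero) (funToFin (f ∘ suc))

  -- `funToFin` splits off the most significant digit, whereas `rev` consumes the least significant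
  -- one; this bridges the two recursions.
  fromDigits-last : ∀ a (f : Fin (suc a) → Fin 2) →
                    fromDigits f ≡ fromDigits (f ∘ inject₁) * 2 + toℕ (f (fromℕ a))
  fromDigits-last zero    f = trans (fromDigits-suc f) (trans (+-identityʳ _) (*-identityˡ _))
  fromDigits-last (suc a) f = begin
    fromDigits f
      ≡⟨ fromDigits-suc f ⟩
    2 ^ suc a * d + fromDigits (f ∘ suc)
      ≡⟨ cong (2 ^ suc a * d +_) (fromDigits-last a (f ∘ suc)) ⟩
    2 ^ suc a * d + (fromDigits (f ∘ suc ∘ inject₁) * 2 + l)
      ≡⟨ rearrange (2 ^ a) d (fromDigits (f ∘ suc ∘ inject₁)) l ⟩
    (2 ^ a * d + fromDigits (f ∘ suc ∘ inject₁)) * 2 + l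
      ≡⟨ cong (λ v → v * 2 + l) (fromDigits-suc (f ∘ inject₁)) ⟨
    fromDigits (f ∘ inject₁) * 2 + l
      ∎
    where
    open ≡-Reasoning
    d = toℕ (f zero)
    l = toℕ (f (suc (fromℕ a)))
    rearrange : ∀ p d v l → 2 * p * d + (v * 2 + l) ≡ (p * d + v) * 2 + l
    rearrange = solve-∀

  rev-fromDigits : ∀ a (f : Fin a → Fin 2) → rev a (fromDigits f) ≡ fromDigits (f ∘ opposite)
  rev-fromDigits zero    f = refl
  rev-fromDigits (suc a) f = begin
    rev (suc a) (fromDigits f)
      ≡⟨ cong (rev (suc a)) (fromDigits-last a f) ⟩
    rev (suc a) (v * 2 + l)
      ≡⟨ cong₂ (λ e w → e * 2 ^ a + rev a w) ([q*n+r]%n≡r v {2} (Fin.toℕ<n (f (fromℕ a)))) ([q*n+r]/n≡q v {2} (Fin.toℕ<n (f (fromℕ a)))) ⟩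
    l * 2 ^ a + rev a v
      ≡⟨ cong₂ _+_ (*-comm l (2 ^ a)) (rev-fromDigits a (f ∘ inject₁)) ⟩
    2 ^ a * l + fromDigits (f ∘ inject₁ ∘ opposite)
      ≡⟨ fromDigits-suc (f ∘ opposite) ⟨
    fromDigits (f ∘ opposite)
      ∎
    where
    open ≡-Reasoning
    v = fromDigits (f ∘ inject₁)
    l = toℕ (f (fromℕ a))

toℕ-bitReversal : ∀ α i → toℕ (bitReversal α i) ≡ rev α (toℕ i)
toℕ-bitReversal α i = begin
  toℕ (bitReversal α i)                ≡⟨ rev-fromDigits α (finToFun i) ⟨
  rev α (fromDigits (finToFun {2} {α} i)) ≡⟨ cong (rev α ∘ toℕ) (Fin.funToFin-finToFin {α} {2} i) ⟩
  rev α (toℕ i)                        ∎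
  where open ≡-Reasoning

-- Finite sums and double counting.

∑ : ℕ → (ℕ → ℕ) → ℕ
∑ zero    f = 0
∑ (suc n) f = ∑ n f + f n

∑-mono : ∀ n {f g} → (∀ {i} → i < n → f i ≤ g i) → ∑ n f ≤ ∑ n g
∑-mono zero    f≤g = z≤n
∑-mono (suc n) f≤g = +-mono-≤ (∑-mono n (λ i<n → f≤g (m≤n⇒m≤1+n i<n))) (f≤g ≤-refl)

∑-cong : ∀ n {f g} → (∀ i → f i ≡ g i) → ∑ n f ≡ ∑ n g
∑-cong zero    f≡g = refl
∑-cong (suc n) f≡g = cong₂ _+_ (∑-cong n f≡g) (f≡g n)

∑-const : ∀ n c → ∑ n (λ _ → c) ≡ n * c
∑-const zero    c = refl
∑-const (suc n) c = trans (cong (_+ c) (∑-const n c)) (+-comm (n * c) c)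

∑-+ : ∀ n f g → ∑ n (λ i → f i + g i) ≡ ∑ n f + ∑ n g
∑-+ zero    f g = refl
∑-+ (suc n) f g = trans (cong (_+ (f n + g n)) (∑-+ n f g)) (rearrange (∑ n f) (∑ n g) (f n) (g n))
  where
  rearrange : ∀ a b c d → a + b + (c + d) ≡ a + c + (b + d)
  rearrange = solve-∀

∑-zero : ∀ n f → (∀ {i} → i < n → f i ≤ 0) → ∑ n f ≤ 0
∑-zero n f f≤0 = ≤-trans (∑-mono n f≤0) (≤-reflexive (trans (∑-const n 0) (*-zeroʳ n)))

∑-*ˡ : ∀ n c f → ∑ n (λ i → c * f i) ≡ c * ∑ n f
∑-*ˡ zero    c f = sym (*-zeroʳ c)
∑-*ˡ (suc n) c f = trans (cong (_+ c * f n) (∑-*ˡ n c f)) (sym (*-distribˡ-+ c (∑ n f) (f n)))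

∑-swap : ∀ n k (f : ℕ → ℕ → ℕ) → ∑ n (λ i → ∑ k (f i)) ≡ ∑ k (λ j → ∑ n (λ i → f i j))
∑-swap zero    k f = sym (trans (∑-const k 0) (*-zeroʳ k))
∑-swap (suc n) k f = trans (cong (_+ ∑ k (f n)) (∑-swap n k f)) (sym (∑-+ k (λ j → ∑ n (λ i → f i j)) (f n)))

∑-prefix : ∀ {m n} f → m ≤ n → ∑ m f ≤ ∑ n f
∑-prefix {n = zero}  f z≤n = z≤n
∑-prefix {n = suc n} f m≤1+n with m≤n⇒m<n∨m≡n m≤1+n
... | inj₁ (s≤s m≤n) = ≤-trans (∑-prefix f m≤n) (m≤m+n (∑ n f) (f n))
... | inj₂ refl      = ≤-refl

∑-term : ∀ {n i} f → i < n → f i ≤ ∑ n f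
∑-term {i = i} f i<n = ≤-trans (m≤n+m (f i) (∑ i f)) (∑-prefix f i<n)

∑-++ : ∀ m n f → ∑ (m + n) f ≡ ∑ m f + ∑ n (λ i → f (m + i))
∑-++ m zero    f = trans (cong (λ k → ∑ k f) (+-identityʳ m)) (sym (+-identityʳ (∑ m f)))
∑-++ m (suc n) f = begin
  ∑ (m + suc n) f                                 ≡⟨ cong (λ k → ∑ k f) (+-suc m n) ⟩
  ∑ (m + n) f + f (m + n)                         ≡⟨ cong (_+ f (m + n)) (∑-++ m n f) ⟩
  ∑ m f + ∑ n (λ i → f (m + i)) + f (m + n)       ≡⟨ +-assoc (∑ m f) _ _ ⟩
  ∑ m f + (∑ n (λ i → f (m + i)) + f (m + n))     ∎
  where open ≡-Reasoning

∑-blocks : ∀ q w f → ∑ (q * w) f ≡ ∑ q (λ t → ∑ w (λ i → f (t * w + i)))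
∑-blocks zero    w f = refl
∑-blocks (suc q) w f = begin
  ∑ (w + q * w) f                               ≡⟨ cong (λ k → ∑ k f) (+-comm w (q * w)) ⟩
  ∑ (q * w + w) f                               ≡⟨ ∑-++ (q * w) w f ⟩
  ∑ (q * w) f + ∑ w (λ i → f (q * w + i))       ≡⟨ cong (_+ ∑ w (λ i → f (q * w + i))) (∑-blocks q w f) ⟩
  ∑ (suc q) (λ t → ∑ w (λ i → f (t * w + i)))   ∎
  where open ≡-Reasoning

∑≢0 : ∀ n f → ∑ n f ≢ 0 → ∃[ i ] i < n × f i ≢ 0
∑≢0 zero    f ∑≢ = contradiction refl ∑≢
∑≢0 (suc n) f ∑≢ with f n ≟ 0
... | no fn≢0  = n , ≤-refl , fn≢0
... | yes fn≡0 with ∑≢0 n f (λ ∑≡0 → ∑≢ (cong₂ _+_ ∑≡0 fn≡0))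
...   | i , i<n , fi≢0 = i , m≤n⇒m≤1+n i<n , fi≢0

∑-subsingleton : ∀ n f {w} → (∀ {i} → i < n → f i ≤ w) →
                 (∀ {i j} → i < n → j < n → f i ≢ 0 → f j ≢ 0 → i ≡ j) → ∑ n f ≤ w
∑-subsingleton zero    f f≤w unique = z≤n
∑-subsingleton (suc n) f f≤w unique with ∑ n f ≟ 0 | f n ≟ 0
... | yes ∑≡0 | _        = subst (λ s → s + f n ≤ _) (sym ∑≡0) (f≤w ≤-refl)
... | no _    | yes fn≡0 = subst (λ x → ∑ n f + x ≤ _) (sym fn≡0) (subst (_≤ _) (sym (+-identityʳ (∑ n f)))
                             (∑-subsingleton n f (λ i<n → f≤w (m≤n⇒m≤1+n i<n))
                                (λ i<n j<n → unique (m≤n⇒m≤1+n i<n) (m≤n⇒m≤1+n j<n))))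
... | no ∑≢0′ | no fn≢0 with ∑≢0 n f ∑≢0′
...   | i , i<n , fi≢0 = contradiction (unique (m≤n⇒m≤1+n i<n) ≤-refl fi≢0 fn≢0) (<⇒≢ i<n)

when : {P : Set} → Dec P → ℕ → ℕ
when (yes _) x = x
when (no _)  x = 0

module _ {P : Set} where

  when-yes : (P? : Dec P) {x : ℕ} → P → when P? x ≡ x
  when-yes (yes _) _ = refl
  when-yes (no ¬p) p = contradiction p ¬p

  when≢0 : (P? : Dec P) {x : ℕ} → when P? x ≢ 0 → P
  when≢0 (yes p) _  = p
  when≢0 (no _)  ≢0 = contradiction refl ≢0

  when≤ : (P? : Dec P) (x : ℕ) → when P? x ≤ x
  when≤ (yes _) x = ≤-refl
  when≤ (no _)  x = z≤n

-- Each weight is filed under the value `v < N` of its key. With the sum over `v` moved outermost,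
-- injectivity leaves at most one nonzero term for each `v`.
∑∑-keyed : ∀ a b {P : ℕ → ℕ → Set} (P? : ∀ u e → Dec (P u e)) (key : ℕ → ℕ → ℕ) N w →
           (∀ {u e} → u < a → e < b → P u e → key u e < N) →
           (∀ {u e u′ e′} → u < a → e < b → u′ < a → e′ < b → P u e → P u′ e′ →
              key u e ≡ key u′ e′ → u ≡ u′ × e ≡ e′) →
           ∑ a (λ u → ∑ b (λ e → when (P? u e) w)) ≤ N * w
∑∑-keyed a b {P} P? key N w key<N key-injective = begin
  ∑ a (λ u → ∑ b (λ e → when (P? u e) w))
    ≤⟨ ∑-mono a (λ u<a → ∑-mono b (λ e<b → at-key u<a e<b)) ⟩
  ∑ a (λ u → ∑ b (λ e → ∑ N (λ v → term u e v)))
    ≡⟨ ∑-cong a (λ u → ∑-swap b N (term u)) ⟩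
  ∑ a (λ u → ∑ N (λ v → ∑ b (λ e → term u e v)))
    ≡⟨ ∑-swap a N (λ u v → ∑ b (λ e → term u e v)) ⟩
  ∑ N (λ v → ∑ a (λ u → ∑ b (λ e → term u e v)))
    ≤⟨ ∑-mono N (λ {v} _ → ≤w v) ⟩
  ∑ N (λ _ → w)
    ≡⟨ ∑-const N w ⟩
  N * w ∎
  where
  open ≤-Reasoning
  term : ℕ → ℕ → ℕ → ℕ
  term u e v = when (key u e ≟ v) (when (P? u e) w)

  at-key : ∀ {u e} → u < a → e < b → when (P? u e) w ≤ ∑ N (λ v → term u e v)
  at-key {u} {e} u<a e<b with P? u e
  ... | no _  = z≤n
  ... | yes p = subst (_≤ ∑ N (λ v → when (key u e ≟ v) w)) (when-yes (key u e ≟ key u e) refl)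
                  (∑-term (λ v → when (key u e ≟ v) w) (key<N u<a e<b p))

  both : ∀ {u e v} → term u e v ≢ 0 → key u e ≡ v × P u e
  both {u} {e} {v} ≢0 = k , when≢0 (P? u e) (λ ≡0 → ≢0 (trans (when-yes (key u e ≟ v) k) ≡0))
    where k = when≢0 (key u e ≟ v) ≢0

  ≤w : ∀ v → ∑ a (λ u → ∑ b (λ e → term u e v)) ≤ w
  ≤w v = ∑-subsingleton a _
    (λ {u} u<a → ∑-subsingleton b _
      (λ {e} _ → ≤-trans (when≤ (key u e ≟ v) _) (when≤ (P? u e) w))
      (λ e<b e′<b ≢0 ≢0′ → proj₂ (same u<a e<b u<a e′<b ≢0 ≢0′)))
    (λ {u} {u′} u<a u′<a ≢0 ≢0′ → let (e , e<b , x) = ∑≢0 b _ ≢0 ; (e′ , e′<b , x′) = ∑≢0 b _ ≢0′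
                                   in proj₁ (same u<a e<b u′<a e′<b x x′))
    where
    same : ∀ {u e u′ e′} → u < a → e < b → u′ < a → e′ < b → term u e v ≢ 0 → term u′ e′ v ≢ 0 → u ≡ u′ × e ≡ e′
    same u<a e<b u′<a e′<b x x′ =
      let (k , p) = both x ; (k′ , p′) = both x′
      in key-injective u<a e<b u′<a e′<b p p′ (trans k (sym k′))

-- Charging descents to long jumps.

m<[1+m/n]*n : ∀ m n .⦃ _ : NonZero n ⦄ → m < suc (m / n) * n
m<[1+m/n]*n m n = begin-strict
  m                 ≡⟨ m≡m%n+[m/n]*n m n ⟩
  m % n + m / n * n <⟨ +-monoˡ-< (m / n * n) (m%n<n m n) ⟩
  n + m / n * n     ∎
  where open ≤-Reasoning

[m+o]/n≤ : ∀ m o n .⦃ _ : NonZero n ⦄ → (m + o) / n ≤ suc (m / n + o / n)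
[m+o]/n≤ m o n = s≤s⁻¹ (m<n*o⇒m/o<n (begin-strict
  m + o                                 <⟨ +-mono-< (m<[1+m/n]*n m n) (m<[1+m/n]*n o n) ⟩
  suc (m / n) * n + suc (o / n) * n     ≡⟨ rearrange (m / n) (o / n) n ⟩
  suc (suc (m / n + o / n)) * n         ∎))
  where
  open ≤-Reasoning
  rearrange : ∀ x y n → (1 + x) * n + (1 + y) * n ≡ (2 + (x + y)) * n
  rearrange = solve-∀

^-cancel-≤ : ∀ {b} .⦃ _ : NonTrivial b ⦄ {x y} → b ^ x ≤ b ^ y → x ≤ y
^-cancel-≤ {b} b^x≤b^y = ≮⇒≥ (λ y<x → <⇒≱ (^-monoʳ-< b (nonTrivial⇒n>1 b) y<x) b^x≤b^y)

-- Phrase j < f occupies the columns lo j ≤ c < hi j of block (block j) and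
-- copies them from the block jump j rows above.
module Charging (β f h : ℕ) (block jump lo hi : ℕ → ℕ) (dep : ℕ → ℕ → ℕ) where

  private
    α = suc β

  -- Describes the phrase holding `𝚊 i` in block `t`, strictly below its first occurrence in block
  -- `rev α i`. By `jump≤` the jump does not pass that first occurrence. By `copies` every column of
  -- the phrase that shows its own letter in block `t` does so in the source block too.
  record Covers (t i j : ℕ) : Set where
    field
      j<f     : j < f
      block≡  : block j ≡ t
      lo≤     : lo j ≤ i
      <hi     : i < hi j
      0<jump  : 0 < jump j
      jump≤   : jump j + rev α i ≤ t
      dep<    : dep (t ∸ jump j) i < dep t i
      copies  : ∀ {c} → lo j ≤ c → c < hi j → rev α c ≤ t → rev α c + jump j ≤ t

  module _
    (dep≤h  : ∀ {t i} → i < 2 ^ α → rev α i ≤ t → suc t < 2 ^ α → dep t i ≤ h)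
    (phrase : ℕ → ℕ → ℕ)
    (covers : ∀ {t i} → i < 2 ^ α → rev α i < t → suc t < 2 ^ α → Covers t i (phrase t i))
    where

    open ≤-Reasoning

    longJump : ℕ → ℕ → ℕ
    longJump δ j = when (δ ≤? jump j) (jump j)

    -- The sum runs over all `D` blocks below the first occurrence, not only over those the descent
    -- visits. This overestimates the distance made by long jumps, but it is monotone in `D` and
    -- does not mention the path.
    travel : ℕ → ℕ → ℕ → ℕ
    travel δ i D = ∑ D (λ e → longJump δ (phrase (suc e + rev α i) i))

    -- Jumps shorter than δ contribute at most δ per step to the descent.
    descent : ∀ δ {i} → i < 2 ^ α → ∀ D → suc (D + rev α i) < 2 ^ α →
              D ≤ travel δ i D + δ * dep (D + rev α i) i
    descent δ {i} i<m = <-rec _ step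
      where
      step : ∀ D → (∀ {D′} → D′ < D → suc (D′ + rev α i) < 2 ^ α →
                      D′ ≤ travel δ i D′ + δ * dep (D′ + rev α i) i) →
             suc (D + rev α i) < 2 ^ α → D ≤ travel δ i D + δ * dep (D + rev α i) i
      step zero    _  _ = z≤n
      step (suc D) ih t< = begin
        suc D
          ≡⟨ m∸n+n≡m d≤ ⟨
        D′ + d
          ≤⟨ +-mono-≤ (ih (s≤s D′≤D) (≤-<-trans (s≤s (+-monoˡ-≤ (rev α i) D′≤1+D)) t<)) d≤W+δ ⟩
        travel δ i D′ + δ * dep (D′ + rev α i) i + (W + δ)
          -- The blocks jumped over are added to the sum; the block jumped from is not among them,
          -- so `W` remains available as its term.
          ≤⟨ +-monoˡ-≤ (W + δ) (+-monoˡ-≤ (δ * dep (D′ + rev α i) i) (∑-prefix _ D′≤D)) ⟩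
        travel δ i D + δ * dep (D′ + rev α i) i + (W + δ)
          ≡⟨ rearrange (travel δ i D) δ (dep (D′ + rev α i) i) W ⟩
        travel δ i D + W + δ * suc (dep (D′ + rev α i) i)
          ≤⟨ +-monoʳ-≤ (travel δ i D + W) (*-monoʳ-≤ δ dep<′) ⟩
        travel δ i (suc D) + δ * dep (suc D + rev α i) i
          ∎
        where
        j = phrase (suc D + rev α i) i
        open Covers (covers i<m (s≤s (m≤n+m (rev α i) D)) t<)
        d  = jump j
        D′ = suc D ∸ d
        W  = longJump δ j
        d≤ : d ≤ suc D
        d≤ = +-cancelʳ-≤ (rev α i) d (suc D) jump≤
        D′≤1+D : D′ ≤ suc D
        D′≤1+D = m∸n≤m (suc D) d
        D′≤D : D′ ≤ D
        D′≤D = s≤s⁻¹ (∸-monoʳ-< 0<jump d≤)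
        dep<′ : suc (dep (D′ + rev α i) i) ≤ dep (suc D + rev α i) i
        dep<′ = subst (λ t → suc (dep t i) ≤ dep (suc D + rev α i) i) (+-∸-comm (rev α i) d≤) dep<
        d≤W+δ : d ≤ W + δ
        d≤W+δ with δ ≤? d
        ... | yes _  = m≤m+n d δ
        ... | no δ≰d = ≰⇒≥ δ≰d
        rearrange : ∀ g δ x w → g + δ * x + (w + δ) ≡ g + w + δ * (1 + x)
        rearrange = solve-∀

    inScale? : ∀ δ r j → Dec (δ ≤ jump j × jump j < r)
    inScale? δ r j = (δ ≤? jump j) ×-dec (jump j <? r)

    -- Only the even columns `u * 2` are followed, over the `r₀ = r - 1` blocks below the first
    -- occurrence of their letters. Their reversals are less than `2 ^ β`, so `r ≤ 2 ^ β` keeps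
    -- these blocks inside the string; and no jump met there reaches `r`.
    module _ {δ r₀ : ℕ} (1≤δ : 1 ≤ δ) (r≤M : suc r₀ ≤ 2 ^ β) where

      private
        r = suc r₀
        2^α≡ : 2 ^ α ≡ 2 ^ β + 2 ^ β
        2^α≡ = cong (2 ^ β +_) (+-identityʳ (2 ^ β))

      column< : ∀ {u} → u < 2 ^ β → u * 2 < 2 ^ α
      column< {u} u<M = subst (u * 2 <_) (*-comm (2 ^ β) 2) (*-monoˡ-< 2 u<M)

      start< : ∀ {u e} → u < 2 ^ β → e < r₀ → suc (suc e + rev α (u * 2)) < 2 ^ α
      start< {u} {e} u<M e<r₀ = begin-strict
        suc (suc e + rev α (u * 2)) ≡⟨ cong (λ v → suc (suc e + v)) (rev-even β u) ⟩
        suc (suc e) + rev β u       <⟨ +-mono-≤-< (≤-trans (s≤s e<r₀) r≤M) (rev<2^ β u) ⟩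
        2 ^ β + 2 ^ β               ≡⟨ 2^α≡ ⟨
        2 ^ α                       ∎

      covers′ : ∀ {u e} → u < 2 ^ β → e < r₀ →
                Covers (suc e + rev α (u * 2)) (u * 2) (phrase (suc e + rev α (u * 2)) (u * 2))
      covers′ {u} {e} u<M e<r₀ = covers (column< u<M) (s≤s (m≤n+m (rev α (u * 2)) e)) (start< u<M e<r₀)

      module _ (j : ℕ) where

        private
          d = jump j
          B = block j

          Charged : ℕ → ℕ → Set
          Charged u e = phrase (suc e + rev α (u * 2)) (u * 2) ≡ j

          charged? : ∀ u e → Dec (Charged u e)
          charged? u e = phrase (suc e + rev α (u * 2)) (u * 2) ≟ j

          coversʲ : ∀ {u e} → u < 2 ^ β → e < r₀ → Charged u e → Covers (suc e + rev α (u * 2)) (u * 2) j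
          coversʲ {u} {e} u<M e<r₀ = λ eq → subst (Covers (suc e + rev α (u * 2)) (u * 2)) eq (covers′ u<M e<r₀)

          d<r : ∀ {u e} → u < 2 ^ β → e < r₀ → Charged u e → d < r
          d<r {u} u<M e<r₀ ch = s≤s (≤-trans (+-cancelʳ-≤ (rev α (u * 2)) d _ (Covers.jump≤ (coversʲ u<M e<r₀ ch))) e<r₀)

        -- The lower bound on `d` makes any `d` consecutive integers contain an aligned interval of
        -- length `2 ^ k`; the upper bound gives `d < 4 * 2 ^ k`, so no more than a constant factor
        -- is lost.
        module _ (d<r : d < r) (a k : ℕ) (a+k≡α : a + k ≡ α)
                 (2^k≤ : 2 ^ suc k ≤ suc d) (<2^k : suc d < 2 ^ suc (suc k)) where

          private
            instance _ = m^n≢0 2 k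

            class : ∀ c → rev α c / 2 ^ k ≡ rev a c
            class c = subst (λ x → rev x c / 2 ^ k ≡ rev a c) a+k≡α (rev-/ a k c)

            2*2^k≤ : 2 ^ k + 2 ^ k ≤ suc d
            2*2^k≤ = subst (λ x → 2 ^ k + x ≤ suc d) (+-identityʳ (2 ^ k)) 2^k≤

          -- The d values of rev α in (t − d , t] contain an aligned dyadic
          -- interval of length 2 ^ k, which every 2 ^ a consecutive columns meet.
          phrase-short : ∀ {t i} → suc t < 2 ^ α → Covers t i j → hi j < lo j + 2 ^ a
          phrase-short {t} {i} t< cov = ≰⇒> long⇒⊥
            where
            open Covers cov
            t′ = t ∸ d
            -- The first aligned interval of length `2 ^ k` all of whose elements exceed `t′`.
            v  = suc (t′ / 2 ^ k)
            t≡ : t′ + d ≡ t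
            t≡ = m∸n+n≡m (≤-trans (m≤m+n d (rev α i)) jump≤)
            [1+v]*2^k≤ : suc v * 2 ^ k ≤ suc t
            [1+v]*2^k≤ = begin
              suc v * 2 ^ k                           ≡⟨ rearrange (t′ / 2 ^ k) (2 ^ k) ⟩
              t′ / 2 ^ k * 2 ^ k + (2 ^ k + 2 ^ k)    ≤⟨ +-mono-≤ (m/n*n≤m t′ (2 ^ k)) 2*2^k≤ ⟩
              t′ + suc d                              ≡⟨ +-suc t′ d ⟩
              suc (t′ + d)                            ≡⟨ cong suc t≡ ⟩
              suc t                                   ∎
              where
              rearrange : ∀ x p → (2 + x) * p ≡ x * p + (p + p)
              rearrange = solve-∀
            v< : v < 2 ^ a
            v< = ≤-trans (n≤1+n (suc v)) (*-cancelʳ-< (2 ^ k) (suc v) (2 ^ a) (begin-strict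
              suc v * 2 ^ k   ≤⟨ [1+v]*2^k≤ ⟩
              suc t           <⟨ t< ⟩
              2 ^ α           ≡⟨ cong (2 ^_) a+k≡α ⟨
              2 ^ (a + k)     ≡⟨ ^-distribˡ-+-* 2 a k ⟩
              2 ^ a * 2 ^ k   ∎))
            long⇒⊥ : ¬ lo j + 2 ^ a ≤ hi j
            -- A phrase of `2 ^ a` columns would contain a column `c` with `rev α c` in that
            -- interval: its letter is present in block `t` but not yet in the source block `t′`.
            long⇒⊥ long with rev-surjective a v< (lo j)
            ... | c , lo≤c , c< , rev≡v = <⇒≱ t′<rev rev≤t′
              where
              q≡v : rev α c / 2 ^ k ≡ v
              q≡v = trans (class c) rev≡v
              t′<rev : t′ < rev α c
              t′<rev = begin-strict
                t′                        <⟨ m<[1+m/n]*n t′ (2 ^ k) ⟩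
                v * 2 ^ k                 ≡⟨ cong (_* 2 ^ k) q≡v ⟨
                rev α c / 2 ^ k * 2 ^ k   ≤⟨ m/n*n≤m (rev α c) (2 ^ k) ⟩
                rev α c                   ∎
              rev≤t : rev α c ≤ t
              rev≤t = s≤s⁻¹ (begin-strict
                rev α c                         <⟨ m<[1+m/n]*n (rev α c) (2 ^ k) ⟩
                suc (rev α c / 2 ^ k) * 2 ^ k   ≡⟨ cong (λ x → suc x * 2 ^ k) q≡v ⟩
                suc v * 2 ^ k                   ≤⟨ [1+v]*2^k≤ ⟩
                suc t                           ∎)
              rev≤t′ : rev α c ≤ t′
              rev≤t′ = +-cancelʳ-≤ d (rev α c) t′
                (subst (rev α c + d ≤_) (sym t≡) (copies lo≤c (<-≤-trans c< long) rev≤t))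

          private
            v₀ = (B ∸ r) / 2 ^ k
            N  = 2 + r / 2 ^ k

            -- The key is the dyadic class of `rev α (u * 2)`, counted from the class of `B ∸ r`.
            -- Charged pairs satisfy `suc e + rev α (u * 2) ≡ B`, so their reversals lie between
            -- `B ∸ r` and `B` and meet at most `N` classes. The bound `v₀≤` ensures that the
            -- subtraction is not truncated.
            key : ℕ → ℕ → ℕ
            key u e = rev a (u * 2) ∸ v₀

            v₀≤ : ∀ {u e} → u < 2 ^ β → e < r₀ → Charged u e → v₀ ≤ rev a (u * 2)
            v₀≤ {u} {e} u<M e<r₀ ch = subst (v₀ ≤_) (class (u * 2)) (/-monoˡ-≤ (2 ^ k) (begin
              B ∸ r                             ≡⟨ cong (_∸ r) (Covers.block≡ (coversʲ u<M e<r₀ ch)) ⟩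
              (suc e + rev α (u * 2)) ∸ r       ≤⟨ ∸-monoˡ-≤ r (+-monoˡ-≤ (rev α (u * 2)) (m≤n⇒m≤1+n e<r₀)) ⟩
              (r + rev α (u * 2)) ∸ r           ≡⟨ m+n∸m≡n r (rev α (u * 2)) ⟩
              rev α (u * 2)                     ∎))

            key<N : ∀ {u e} → u < 2 ^ β → e < r₀ → Charged u e → key u e < N
            key<N {u} {e} u<M e<r₀ ch = m<n+o⇒m∸n<o (rev a (u * 2)) v₀ (begin-strict
              rev a (u * 2)                     ≡⟨ class (u * 2) ⟨
              rev α (u * 2) / 2 ^ k             ≤⟨ /-monoˡ-≤ (2 ^ k) rev≤ ⟩
              (B ∸ r + r) / 2 ^ k               ≤⟨ [m+o]/n≤ (B ∸ r) r (2 ^ k) ⟩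
              suc (v₀ + r / 2 ^ k)              ≡⟨ +-suc v₀ (r / 2 ^ k) ⟨
              v₀ + suc (r / 2 ^ k)              <⟨ +-monoʳ-< v₀ ≤-refl ⟩
              v₀ + N                            ∎)
              where
              rev≤ : rev α (u * 2) ≤ B ∸ r + r
              rev≤ = begin
                rev α (u * 2)                   ≤⟨ m≤n+m (rev α (u * 2)) (suc e) ⟩
                suc e + rev α (u * 2)           ≡⟨ Covers.block≡ (coversʲ u<M e<r₀ ch) ⟨
                B                               ≤⟨ m≤n+m∸n B r ⟩
                r + (B ∸ r)                     ≡⟨ +-comm r (B ∸ r) ⟩
                B ∸ r + r                       ∎

            -- Charged columns lie in a phrase of fewer than `2 ^ a` columns, on which `rev a` is
            -- injective; so the key determines `u`. The block of the phrase then determines `e`.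
            key-injective : ∀ {u e u′ e′} → u < 2 ^ β → e < r₀ → u′ < 2 ^ β → e′ < r₀ →
                            Charged u e → Charged u′ e′ → key u e ≡ key u′ e′ → u ≡ u′ × e ≡ e′
            key-injective {u} {e} {u′} {e′} u<M e<r₀ u′<M e′<r₀ ch ch′ key≡ = u≡u′ , e≡e′
              where
              module X = Covers (coversʲ u<M e<r₀ ch)
              module Y = Covers (coversʲ u′<M e′<r₀ ch′)
              short = phrase-short (start< u<M e<r₀) (coversʲ u<M e<r₀ ch)
              near : ∀ {x y} → x < hi j → lo j ≤ y → x < y + 2 ^ a
              near x<hi lo≤y = <-trans x<hi (<-≤-trans short (+-monoˡ-≤ (2 ^ a) lo≤y))
              u≡u′ : u ≡ u′
              u≡u′ = *-cancelʳ-≡ u u′ 2 (rev-injective a (near X.<hi Y.lo≤) (near Y.<hi X.lo≤)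
                       (∸-cancelʳ-≡ (v₀≤ u<M e<r₀ ch) (v₀≤ u′<M e′<r₀ ch′) key≡))
              e≡e′ : e ≡ e′
              e≡e′ = suc-injective (+-cancelʳ-≡ (rev α (u * 2)) (suc e) (suc e′)
                       (trans (sym X.block≡) (trans Y.block≡ (cong (λ x → suc e′ + rev α (x * 2)) (sym u≡u′)))))

            -- The two extra classes cost at most `4 * r`, since `2 * 2 ^ k ≤ r`, and the
            -- `r / 2 ^ k` others cost at most `4 * r`.
            N*d≤ : N * d ≤ 8 * r
            N*d≤ = begin
              N * d                                           ≤⟨ *-monoʳ-≤ (2 + r / 2 ^ k) (≤-trans (n≤1+n d) (<⇒≤ <2^k)) ⟩
              (2 + r / 2 ^ k) * (2 * (2 * 2 ^ k))             ≡⟨ rearrange (r / 2 ^ k) (2 ^ k) ⟩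
              4 * (2 * 2 ^ k) + 4 * (r / 2 ^ k * 2 ^ k)       ≤⟨ +-mono-≤ (*-monoʳ-≤ 4 (≤-trans 2^k≤ d<r)) (*-monoʳ-≤ 4 (m/n*n≤m r (2 ^ k))) ⟩
              4 * r + 4 * r                                   ≡⟨ *-distribʳ-+ r 4 4 ⟨
              8 * r                                           ∎
              where
              rearrange : ∀ x p → (2 + x) * (2 * (2 * p)) ≡ 4 * (2 * p) + 4 * (x * p)
              rearrange = solve-∀

          charge-dyadic : ∑ (2 ^ β) (λ u → ∑ r₀ (λ e → when (charged? u e) d)) ≤ 8 * r
          charge-dyadic = ≤-trans (∑∑-keyed (2 ^ β) r₀ charged? key N d key<N key-injective) N*d≤

        -- Outside the scale nothing is charged: a jump below `δ` has weight 0, and a jump of `r` or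
        -- more would lead above the first occurrence of any letter followed here.
        charge : ∑ (2 ^ β) (λ u → ∑ r₀ (λ e → when (charged? u e) (longJump δ j))) ≤
                 when (inScale? δ r j) (8 * r)
        charge with δ ≤? d | d <? r
        ... | yes δ≤d | yes d<r = dyadic (2^-bracket d)
          where
          dyadic : ∃[ x ] 2 ^ x ≤ suc d × suc d < 2 ^ suc x → _
          -- As `d ≥ δ ≥ 1`, the bracketing exponent of `suc d` is positive; `k` is that exponent
          -- minus one.
          dyadic (zero  , _ , <2) = contradiction <2 (≤⇒≯ (s≤s (≤-trans 1≤δ δ≤d)))
          dyadic (suc k , 2^k≤ , <2^k) = charge-dyadic d<r (α ∸ k) k (m∸n+n≡m k≤α) 2^k≤ <2^k
            where
            k≤α : k ≤ α
            k≤α = m≤n⇒m≤1+n (≤-trans (n≤1+n k) (^-cancel-≤ {2} (≤-trans 2^k≤ (≤-trans d<r r≤M))))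
        ... | yes δ≤d | no d≮r  = ∑-zero (2 ^ β) _ (λ u<M → ∑-zero r₀ _ (λ e<r₀ → uncharged u<M e<r₀))
          where
          uncharged : ∀ {u e} → u < 2 ^ β → e < r₀ → when (charged? u e) d ≤ 0
          uncharged {u} {e} u<M e<r₀ with charged? u e
          ... | yes ch = contradiction (d<r u<M e<r₀ ch) d≮r
          ... | no _   = z≤n
        ... | no _    | _       = ∑-zero (2 ^ β) _ (λ {u} _ → ∑-zero r₀ _ (λ {e} _ → when≤ (charged? u e) 0))

      -- Each of the `2 ^ β` even columns travels at least `r / 2` by long jumps, and each phrase in
      -- the scale absorbs at most `8 * r` of the total; hence the factor 16.
      scale-count : 4 * (δ * h) ≤ r → 4 ≤ r → 2 ^ β ≤ 16 * ∑ f (λ j → when (inScale? δ r j) 1)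
      scale-count 4δh≤r 4≤r = *-cancelʳ-≤ (2 ^ β) _ r (begin
        2 ^ β * r
          ≡⟨ ∑-const (2 ^ β) r ⟨
        ∑ (2 ^ β) (λ _ → r)
          ≤⟨ ∑-mono (2 ^ β) r≤2G ⟩
        ∑ (2 ^ β) (λ u → 2 * travel δ (u * 2) r₀)
          ≡⟨ ∑-*ˡ (2 ^ β) 2 _ ⟩
        2 * ∑ (2 ^ β) (λ u → travel δ (u * 2) r₀)
          ≤⟨ *-monoʳ-≤ 2 (∑-mono (2 ^ β) (λ u<M → ∑-mono r₀ (λ e<r₀ → to-phrase u<M e<r₀))) ⟩
        2 * ∑ (2 ^ β) (λ u → ∑ r₀ (λ e → ∑ f (λ j → term u e j)))
          ≡⟨ cong (2 *_) (∑-cong (2 ^ β) (λ u → ∑-swap r₀ f (term u))) ⟩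
        2 * ∑ (2 ^ β) (λ u → ∑ f (λ j → ∑ r₀ (λ e → term u e j)))
          ≡⟨ cong (2 *_) (∑-swap (2 ^ β) f (λ u j → ∑ r₀ (λ e → term u e j))) ⟩
        2 * ∑ f (λ j → ∑ (2 ^ β) (λ u → ∑ r₀ (λ e → term u e j)))
          ≤⟨ *-monoʳ-≤ 2 (∑-mono f (λ {j} _ → ≤-trans (charge j) (when-* j))) ⟩
        2 * ∑ f (λ j → 8 * r * when (inScale? δ r j) 1)
          ≡⟨ cong (2 *_) (∑-*ˡ f (8 * r) _) ⟩
        2 * (8 * r * ∑ f (λ j → when (inScale? δ r j) 1))
          ≡⟨ rearrange r (∑ f (λ j → when (inScale? δ r j) 1)) ⟩
        16 * ∑ f (λ j → when (inScale? δ r j) 1) * r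
          ∎)
        where
        rearrange : ∀ r x → 2 * (8 * r * x) ≡ 16 * x * r
        rearrange = solve-∀
        term : ℕ → ℕ → ℕ → ℕ
        term u e j = when (phrase (suc e + rev α (u * 2)) (u * 2) ≟ j) (longJump δ j)
        when-* : ∀ j → when (inScale? δ r j) (8 * r) ≤ 8 * r * when (inScale? δ r j) 1
        when-* j with inScale? δ r j
        ... | yes _ = ≤-reflexive (sym (*-identityʳ (8 * r)))
        ... | no _  = z≤n
        to-phrase : ∀ {u e} → u < 2 ^ β → e < r₀ →
                    longJump δ (phrase (suc e + rev α (u * 2)) (u * 2)) ≤ ∑ f (term u e)
        to-phrase {u} {e} u<M e<r₀ = begin
          longJump δ p    ≡⟨ when-yes (p ≟ p) refl ⟨
          term u e p      ≤⟨ ∑-term (term u e) (Covers.j<f (covers′ u<M e<r₀)) ⟩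
          ∑ f (term u e)  ∎
          where p = phrase (suc e + rev α (u * 2)) (u * 2)
        r≤2G : ∀ {u} → u < 2 ^ β → r ≤ 2 * travel δ (u * 2) r₀
        -- `4 ≤ r` absorbs the loss of one in `r = suc r₀`, and `4 * (δ * h) ≤ r` absorbs the short
        -- jumps.
        r≤2G {u} u<M = *-cancelˡ-≤ 2 (+-cancelˡ-≤ (2 * r) (2 * r) _ (begin
          2 * r + 2 * r                           ≡⟨ four r ⟩
          4 * suc r₀                              ≤⟨ *-monoʳ-≤ 4 (s≤s r₀≤) ⟩
          4 * suc (G + δ * h)                     ≡⟨ spread G (δ * h) ⟩
          4 + 4 * (δ * h) + 2 * (2 * G)           ≤⟨ +-monoˡ-≤ (2 * (2 * G)) (+-mono-≤ 4≤r 4δh≤r) ⟩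
          r + r + 2 * (2 * G)                     ≡⟨ cong (λ x → r + x + 2 * (2 * G)) (+-identityʳ r) ⟨
          2 * r + 2 * (2 * G)                     ∎))
          where
          G = travel δ (u * 2) r₀
          π<M : rev α (u * 2) < 2 ^ β
          π<M = subst (_< 2 ^ β) (sym (rev-even β u)) (rev<2^ β u)
          top< : suc (r₀ + rev α (u * 2)) < 2 ^ α
          top< = subst (suc (r₀ + rev α (u * 2)) <_) (sym 2^α≡) (+-mono-≤-< r≤M π<M)
          r₀≤ : r₀ ≤ G + δ * h
          r₀≤ = ≤-trans (descent δ (column< u<M) r₀ top<)
                  (+-monoʳ-≤ G (*-monoʳ-≤ δ (dep≤h (column< u<M) (m≤n+m (rev α (u * 2)) r₀) top<)))
          four : ∀ x → 2 * x + 2 * x ≡ 4 * x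
          four = solve-∀
          spread : ∀ g x → 4 * (1 + (g + x)) ≡ 4 + 4 * x + 2 * (2 * g)
          spread = solve-∀

    -- The scales from `H ^ s` to `H ^ suc s` are disjoint, so each phrase is counted at most once,
    -- and `4 * h ≤ H` is what `scale-count` needs of their ratio.
    all-scales : ∀ H σ → 1 ≤ h → 4 * h ≤ H → H ^ σ ≤ 2 ^ β → σ * 2 ^ β ≤ 16 * f
    all-scales H σ 1≤h 4h≤H H^σ≤M = begin
      σ * 2 ^ β
        ≡⟨ ∑-const σ (2 ^ β) ⟨
      ∑ σ (λ _ → 2 ^ β)
        ≤⟨ ∑-mono σ at-scale ⟩
      ∑ σ (λ s → 16 * ∑ f (λ j → when (inScale? (H ^ s) (H ^ suc s) j) 1))
        ≡⟨ ∑-*ˡ σ 16 _ ⟩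
      16 * ∑ σ (λ s → ∑ f (λ j → when (inScale? (H ^ s) (H ^ suc s) j) 1))
        ≡⟨ cong (16 *_) (∑-swap σ f _) ⟩
      16 * ∑ f (λ j → ∑ σ (λ s → when (inScale? (H ^ s) (H ^ suc s) j) 1))
        ≤⟨ *-monoʳ-≤ 16 (∑-mono f (λ {j} _ → one-scale j)) ⟩
      16 * ∑ f (λ _ → 1)
        ≡⟨ cong (16 *_) (trans (∑-const f 1) (*-identityʳ f)) ⟩
      16 * f ∎
      where
      4≤H : 4 ≤ H
      4≤H = ≤-trans (*-monoʳ-≤ 4 1≤h) 4h≤H
      instance _ = >-nonZero (≤-trans (s≤s z≤n) 4≤H)
      at-scale : ∀ {s} → s < σ → 2 ^ β ≤ 16 * ∑ f (λ j → when (inScale? (H ^ s) (H ^ suc s) j) 1)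
      -- The upper end is exposed as a successor, the form `suc r₀` in which scales are treated.
      at-scale {s} s<σ with H ^ suc s in eq
      ... | zero   = contradiction eq (≢-nonZero⁻¹ _ ⦃ m^n≢0 H (suc s) ⦄)
      ... | suc r₀ = scale-count (m^n>0 H s) (subst (_≤ 2 ^ β) eq (≤-trans (^-monoʳ-≤ H s<σ) H^σ≤M))
          (subst (4 * (H ^ s * h) ≤_) eq (begin
            4 * (H ^ s * h)   ≡⟨ cong (4 *_) (*-comm (H ^ s) h) ⟩
            4 * (h * H ^ s)   ≡⟨ *-assoc 4 h (H ^ s) ⟨
            4 * h * H ^ s     ≤⟨ *-monoˡ-≤ (H ^ s) 4h≤H ⟩
            H * H ^ s         ∎))
          (subst (4 ≤_) eq (≤-trans 4≤H (m≤m*n H (H ^ s) ⦃ m^n≢0 H s ⦄)))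
      one-scale : ∀ j → ∑ σ (λ s → when (inScale? (H ^ s) (H ^ suc s) j) 1) ≤ 1
      one-scale j = ∑-subsingleton σ _ (λ {s} _ → when≤ (inScale? (H ^ s) (H ^ suc s) j) 1) same
        where
        above : ∀ {s s′} → H ^ s′ ≤ jump j → jump j < H ^ suc s → s′ ≤ s
        above {s} {s′} ≤d d< = ≮⇒≥ (λ s<s′ → <⇒≱ d< (≤-trans (^-monoʳ-≤ H s<s′) ≤d))
        same : ∀ {s s′} → s < σ → s′ < σ → when (inScale? (H ^ s) (H ^ suc s) j) 1 ≢ 0 →
               when (inScale? (H ^ s′) (H ^ suc s′) j) 1 ≢ 0 → s ≡ s′
        same {s} {s′} _ _ ≢0 ≢0′ =
          let (≤d , d<) = when≢0 (inScale? (H ^ s) (H ^ suc s) j) ≢0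
              (≤d′ , d<′) = when≢0 (inScale? (H ^ s′) (H ^ suc s′) j) ≢0′
          in ≤-antisym (above ≤d d<′) (above ≤d′ d<)

-- Characters of a list by position.

infixl 9 _‼_

-- Defined through `drop`, like `substring`, so that offsets combine by `drop-drop`.
_‼_ : {A : Set} → List A → ℕ → Maybe A
xs ‼ p = head (drop p xs)

module _ {A : Set} where

  ‼-drop : ∀ p o (xs : List A) → drop p xs ‼ o ≡ xs ‼ (p + o)
  ‼-drop p o xs = cong head (drop-drop p o xs)

  ‼-take : ∀ {o ℓ} (xs : List A) → o < ℓ → take ℓ xs ‼ o ≡ xs ‼ o
  ‼-take {zero}  {suc ℓ} []       _         = refl
  ‼-take {zero}  {suc ℓ} (x ∷ xs) _         = refl
  ‼-take {suc o} {suc ℓ} []       _         = refl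
  ‼-take {suc o} {suc ℓ} (x ∷ xs) (s≤s o<ℓ) = ‼-take xs o<ℓ

  ‼-just⇒< : ∀ (xs : List A) p {c} → xs ‼ p ≡ just c → p < length xs
  ‼-just⇒< []       zero    ()
  ‼-just⇒< []       (suc p) ()
  ‼-just⇒< (x ∷ xs) zero    _  = s≤s z≤n
  ‼-just⇒< (x ∷ xs) (suc p) eq = s≤s (‼-just⇒< xs p eq)

  <⇒‼-just : ∀ (xs : List A) {p} → p < length xs → ∃[ c ] xs ‼ p ≡ just c
  <⇒‼-just (x ∷ xs) {zero}  _         = x , refl
  <⇒‼-just (x ∷ xs) {suc p} (s≤s p<) = <⇒‼-just xs p<

  ‼-++ˡ : ∀ (xs : List A) {ys i} → i < length xs → (xs ++ ys) ‼ i ≡ xs ‼ i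
  ‼-++ˡ (x ∷ xs) {i = zero}  _         = refl
  ‼-++ˡ (x ∷ xs) {i = suc i} (s≤s i<) = ‼-++ˡ xs i<

  ‼-++ʳ : ∀ (xs : List A) {ys} i → (xs ++ ys) ‼ (length xs + i) ≡ ys ‼ i
  ‼-++ʳ []       i = refl
  ‼-++ʳ (x ∷ xs) i = ‼-++ʳ xs i

  ‼-tabulate : ∀ {m} (f : Fin m → A) i → tabulate f ‼ toℕ i ≡ just (f i)
  ‼-tabulate f zero    = refl
  ‼-tabulate f (suc i) = ‼-tabulate (f ∘ suc) i

  ‼-concat : ∀ (f : ℕ → List A) {w} → (∀ x → length (f x) ≡ w) →
             ∀ {k t i} → t < k → i < w → concat (applyUpTo f k) ‼ (t * w + i) ≡ f t ‼ i
  ‼-concat f {w} ∣f∣≡w {suc k} {zero} {i} _ i<w = ‼-++ˡ (f 0) (subst (i <_) (sym (∣f∣≡w 0)) i<w)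
  ‼-concat f {w} ∣f∣≡w {suc k} {suc t} {i} (s≤s t<k) i<w = begin
    (f 0 ++ rest) ‼ (w + t * w + i)           ≡⟨ cong ((f 0 ++ rest) ‼_) (+-assoc w (t * w) i) ⟩
    (f 0 ++ rest) ‼ (w + (t * w + i))         ≡⟨ cong (λ ℓ → (f 0 ++ rest) ‼ (ℓ + (t * w + i))) (∣f∣≡w 0) ⟨
    (f 0 ++ rest) ‼ (length (f 0) + (t * w + i)) ≡⟨ ‼-++ʳ (f 0) (t * w + i) ⟩
    rest ‼ (t * w + i)                        ≡⟨ ‼-concat (f ∘ suc) (∣f∣≡w ∘ suc) t<k i<w ⟩
    f (suc t) ‼ i                             ∎
    where
    open ≡-Reasoning
    rest = concat (applyUpTo (f ∘ suc) k)

  take-ext : ∀ ℓ (xs ys : List A) → (∀ {o} → o < ℓ → xs ‼ o ≡ ys ‼ o) → take ℓ xs ≡ take ℓ ys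
  take-ext zero    xs       ys       eq = refl
  take-ext (suc ℓ) []       []       eq = refl
  take-ext (suc ℓ) []       (y ∷ ys) eq = contradiction (eq (s≤s z≤n)) λ ()
  take-ext (suc ℓ) (x ∷ xs) []       eq = contradiction (eq (s≤s z≤n)) λ ()
  take-ext (suc ℓ) (x ∷ xs) (y ∷ ys) eq =
    cong₂ _∷_ (just-injective (eq (s≤s z≤n))) (take-ext ℓ xs ys (λ o<ℓ → eq (s≤s o<ℓ)))

module _ {T : List Letter} where

  occursAt⇒‼ : ∀ {F p o} → OccursAt T F p → o < length F → T ‼ (p + o) ≡ F ‼ o
  occursAt⇒‼ {F} {p} {o} occ o< = begin
    T ‼ (p + o)                          ≡⟨ ‼-drop p o T ⟨
    drop p T ‼ o                         ≡⟨ ‼-take (drop p T) o< ⟨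
    take (length F) (drop p T) ‼ o       ≡⟨ cong (_‼ o) occ ⟩
    F ‼ o                                ∎
    where open ≡-Reasoning

  substring-ext : ∀ {p q} ℓ → (∀ {o} → o < ℓ → T ‼ (p + o) ≡ T ‼ (q + o)) →
                  substring T p ℓ ≡ substring T q ℓ
  substring-ext {p} {q} ℓ eq = take-ext ℓ (drop p T) (drop q T)
    (λ {o} o<ℓ → trans (‼-drop p o T) (trans (eq o<ℓ) (sym (‼-drop q o T))))

  substring-1 : ∀ p {c} → T ‼ p ≡ just c → substring T p 1 ≡ [ c ]
  substring-1 p eq with drop p T
  substring-1 p refl | c ∷ _ = refl

  ‼⇒occursBefore : ∀ {p q} → p < q → T ‼ p ≡ T ‼ q → q < length T → OccursBefore T (substring T q 1) q
  ‼⇒occursBefore {p} {q} p<q eq q< with <⇒‼-just T q<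
  ... | c , q≡ rewrite substring-1 q q≡ = p , p<q , substring-1 p (trans eq q≡)

-- Blocks and columns of the string.

-- Position pos α t i is column i of block R α (suc t), column 2 ^ α being its $.

width : ℕ → ℕ
width α = suc (2 ^ α)

pos : ℕ → ℕ → ℕ → ℕ
pos α t i = t * width α + i

blocks : ℕ → ℕ
blocks α = 2 ^ α ∸ 1

length-R : ∀ α x → length (R α x) ≡ width α
length-R α x = trans (length-++ (tabulate R[ α , x ]at))
  (trans (+-comm _ 1) (cong suc (length-tabulate R[ α , x ]at)))

module _ (α : ℕ) where

  private
    m = 2 ^ α

  suc-blocks : suc (blocks α) ≡ m
  suc-blocks = m+[n∸m]≡n (m^n>0 2 α)

  n≡ : n α ≡ blocks α * width α
  n≡ = trans (n≡m²∸1 α) (begin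
      m ^ 2 ∸ 1                       ≡⟨ cong (λ x → x ^ 2 ∸ 1) suc-blocks ⟨
      suc b ^ 2 ∸ 1                   ≡⟨ cong (_∸ 1) (square b) ⟩
      b * suc (suc b)                 ≡⟨ cong (λ x → b * suc x) suc-blocks ⟩
      b * width α                     ∎)
    where
    open ≡-Reasoning
    b = blocks α
    square : ∀ b → suc b * (suc b * 1) ≡ suc (b * suc (suc b))
    square = solve-∀

  pos< : ∀ {t i} → t < blocks α → i < width α → pos α t i < n α
  pos< {t} {i} t< i< = subst (pos α t i <_) (sym n≡) (begin-strict
    t * width α + i       <⟨ +-monoʳ-< (t * width α) i< ⟩
    t * width α + width α ≡⟨ +-comm (t * width α) (width α) ⟩
    suc t * width α       ≤⟨ *-monoˡ-≤ (width α) t< ⟩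
    blocks α * width α    ∎)
    where open ≤-Reasoning

  pos-view : ∀ {p} → p < n α → ∃[ t ] ∃[ i ] t < blocks α × i < width α × p ≡ pos α t i
  pos-view {p} p< = p / width α , p % width α ,
    m<n*o⇒m/o<n (subst (p <_) n≡ p<) , m%n<n p (width α) , sym (q*n+r≡m p (width α))

  pos-injective : ∀ {t i t′ i′} → i < width α → i′ < width α → pos α t i ≡ pos α t′ i′ → t ≡ t′ × i ≡ i′
  pos-injective = q*n+r-injective

  private
    S‼ : ∀ {t i} → t < blocks α → i < width α → S α ‼ pos α t i ≡ R α (suc t) ‼ i
    S‼ = ‼-concat (R α ∘ suc) (λ x → length-R α (suc x))

    -- `does (rev α i <? suc t)` reduces to the boolean test in `R[_,_]at`, and makes `dec-true` and
    -- `dec-false` applicable.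
    column : ∀ {t i} → t < blocks α → i < m →
             S α ‼ pos α t i ≡ just (if does (rev α i <? suc t) then 𝚊 i else 𝚋)
    column {t} {i} t< i<m = begin
      S α ‼ pos α t i
        ≡⟨ S‼ t< (m≤n⇒m≤1+n i<m) ⟩
      R α (suc t) ‼ i
        ≡⟨ ‼-++ˡ (tabulate f) (subst (i <_) (sym (length-tabulate f)) i<m) ⟩
      tabulate f ‼ i
        ≡⟨ cong (tabulate f ‼_) (Fin.toℕ-fromℕ< i<m) ⟨
      tabulate f ‼ toℕ (fromℕ< i<m)
        ≡⟨ ‼-tabulate f (fromℕ< i<m) ⟩
      just (f (fromℕ< i<m))
        ≡⟨ cong (λ x → just (if x <ᵇ suc t then 𝚊 (toℕ (fromℕ< i<m)) else 𝚋)) (toℕ-bitReversal α (fromℕ< i<m)) ⟩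
      just (if rev α (toℕ (fromℕ< i<m)) <ᵇ suc t then 𝚊 (toℕ (fromℕ< i<m)) else 𝚋)
        ≡⟨ cong (λ x → just (if rev α x <ᵇ suc t then 𝚊 x else 𝚋)) (Fin.toℕ-fromℕ< i<m) ⟩
      just (if rev α i <ᵇ suc t then 𝚊 i else 𝚋)
        ∎
      where
      open ≡-Reasoning
      f = R[ α , suc t ]at

  S‼-𝚊 : ∀ {t i} → t < blocks α → i < m → rev α i ≤ t → S α ‼ pos α t i ≡ just (𝚊 i)
  S‼-𝚊 {t} {i} t< i<m rev≤t =
    trans (column t< i<m) (cong (λ b → just (if b then 𝚊 i else 𝚋)) (dec-true (rev α i <? suc t) (s≤s rev≤t)))

  S‼-𝚋 : ∀ {t i} → t < blocks α → i < m → t < rev α i → S α ‼ pos α t i ≡ just 𝚋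
  S‼-𝚋 {t} {i} t< i<m t<rev =
    trans (column t< i<m) (cong (λ b → just (if b then 𝚊 i else 𝚋)) (dec-false (rev α i <? suc t) (≤⇒≯ t<rev)))

  S‼-$ : ∀ {t} → t < blocks α → S α ‼ pos α t m ≡ just ($ (suc t))
  S‼-$ {t} t< = trans (S‼ t< ≤-refl) (trans
    (cong (R α (suc t) ‼_) (sym (trans (+-identityʳ _) (length-tabulate f))))
    (‼-++ʳ (tabulate f) 0))
    where f = R[ α , suc t ]at

  data Column (t i : ℕ) : Set where
    is-𝚊 : i < m → rev α i ≤ t → S α ‼ pos α t i ≡ just (𝚊 i) → Column t i
    is-𝚋 : i < m → t < rev α i → S α ‼ pos α t i ≡ just 𝚋 → Column t i
    is-$ : i ≡ m → S α ‼ pos α t i ≡ just ($ (suc t)) → Column t i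

  column-view : ∀ {t i} → t < blocks α → i < width α → Column t i
  column-view {t} {i} t< (s≤s i≤m) with m≤n⇒m<n∨m≡n i≤m
  ... | inj₂ refl = is-$ refl (S‼-$ t<)
  ... | inj₁ i<m with rev α i ≤? t
  ...   | yes rev≤t = is-𝚊 i<m rev≤t (S‼-𝚊 t< i<m rev≤t)
  ...   | no rev≰t  = is-𝚋 i<m (≰⇒> rev≰t) (S‼-𝚋 t< i<m (≰⇒> rev≰t))

  -- As `𝚊 i` occurs in column `i` only, every copy of it stays in its column; this forces sources
  -- to be shifted by whole blocks.
  𝚊-position : ∀ {p i} → S α ‼ p ≡ just (𝚊 i) →
               ∃[ t ] t < blocks α × i < m × rev α i ≤ t × p ≡ pos α t i
  𝚊-position {p} eq with pos-view (‼-just⇒< (S α) p eq)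
  ... | t , i , t< , i< , refl with column-view t< i<
  ...   | is-𝚊 i<m rev≤t eq′ with refl ← trans (sym eq) eq′ = t , t< , i<m , rev≤t , refl
  ...   | is-𝚋 _ _ eq′ = contradiction (trans (sym eq) eq′) λ ()
  ...   | is-$ _ eq′   = contradiction (trans (sym eq) eq′) λ ()

  $-position : ∀ {p t} → S α ‼ p ≡ just ($ (suc t)) → p ≡ pos α t m
  $-position {p} eq with pos-view (‼-just⇒< (S α) p eq)
  ... | t , i , t< , i< , refl with column-view t< i<
  ...   | is-𝚊 _ _ eq′    = contradiction (trans (sym eq) eq′) λ ()
  ...   | is-𝚋 _ _ eq′    = contradiction (trans (sym eq) eq′) λ ()
  ...   | is-$ refl eq′ with refl ← trans (sym eq) eq′ = refl

-- The upper bound on `z`.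

length-phrases≤ : ∀ (rank : ℕ → ℕ) (Fs : List (List Letter)) b →
  (∀ j → rank (b + start Fs j) < rank (b + start Fs j + length (lookup Fs j))) →
  length Fs + rank b ≤ rank (b + length (concat Fs))
length-phrases≤ rank []       b _   = ≤-reflexive (cong rank (sym (+-identityʳ b)))
length-phrases≤ rank (F ∷ Fs) b inc = begin
  suc (length Fs + rank b)                      ≡⟨ +-suc (length Fs) (rank b) ⟨
  length Fs + suc (rank b)                      ≤⟨ +-monoʳ-≤ (length Fs) (subst (λ x → rank x < rank (x + length F)) (+-identityʳ b) (inc zero)) ⟩
  length Fs + rank (b + length F)               ≤⟨ length-phrases≤ rank Fs (b + length F) inc′ ⟩
  rank (b + length F + length (concat Fs))      ≡⟨ cong rank (+-assoc b (length F) (length (concat Fs))) ⟩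
  rank (b + (length F + length (concat Fs)))    ≡⟨ cong (λ ℓ → rank (b + ℓ)) (length-++ F) ⟨
  rank (b + length (concat (F ∷ Fs)))           ∎
  where
  open ≤-Reasoning hiding (start)
  inc′ : ∀ j → rank (b + length F + start Fs j) < rank (b + length F + start Fs j + length (lookup Fs j))
  inc′ j = subst (λ x → rank x < rank (x + length (lookup Fs j))) (sym (+-assoc b (length F) (start Fs j))) (inc (suc j))

module _ {Fs : List (List Letter)} where

  start+length≤ : ∀ j → start Fs j + length (lookup Fs j) ≤ length (concat Fs)
  start+length≤ = go Fs
    where
    go : ∀ Fs j → start Fs j + length (lookup Fs j) ≤ length (concat Fs)
    go (F ∷ Fs) zero    = subst (length F ≤_) (sym (length-++ F)) (m≤m+n (length F) _)
    go (F ∷ Fs) (suc j) = subst₂ _≤_ (sym (+-assoc (length F) (start Fs j) _)) (sym (length-++ F))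
                            (+-monoʳ-≤ (length F) (go Fs j))

  0<length-phrase : All (_≢ []) Fs → ∀ j → 0 < length (lookup Fs j)
  0<length-phrase nonempty j with lookup Fs j | All.lookup nonempty (∈-lookup {xs = Fs} j)
  ... | []    | ≢[] = contradiction refl ≢[]
  ... | _ ∷ _ | _   = s≤s z≤n

module _ (α : ℕ) where

  private
    m = 2 ^ α
    w = width α

  -- `q ∸ w` is the same column one block above. The condition `w ≤ q` rules out truncation, so
  -- block 0 is entirely fresh.
  Copied : ℕ → Set
  Copied q = w ≤ q × S α ‼ q ≡ S α ‼ (q ∸ w)

  copied? : ∀ q → Dec (Copied q)
  copied? q = (w ≤? q) ×-dec ≡-dec _≟ᴸ_ (S α ‼ q) (S α ‼ (q ∸ w))

  fresh : ℕ → ℕ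
  fresh q = when (¬? (copied? q)) 1

  fresh≤1 : ∀ q → fresh q ≤ 1
  fresh≤1 q = when≤ (¬? (copied? q)) 1

  fresh≡0⇒copied : ∀ {q} → fresh q ≡ 0 → Copied q
  fresh≡0⇒copied {q} eq = decidable-stable (copied? q)
    (λ ¬c → contradiction (trans (sym (when-yes (¬? (copied? q)) ¬c)) eq) λ ())

  -- The end of the string is never copied: lookup there gives `nothing`, while the position one
  -- block above, if there is one, holds a letter.
  copied⇒<n : ∀ {q} → q ≤ n α → Copied q → q < n α
  copied⇒<n {q} q≤n (w≤q , eq) =
    let (c , at) = <⇒‼-just (S α) (<-≤-trans (∸-monoʳ-< {q} (s≤s z≤n) w≤q) q≤n)
    in ‼-just⇒< (S α) q (trans eq at)

  -- The sum includes the position right after the phrase. If all these positions were copied, the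
  -- phrase extended by one character would occur one block earlier, against its maximality or
  -- against its being a first occurrence.
  lz-phrase-fresh : ∀ {p F} → p + length F ≤ n α → IsLZPhrase (S α) p F →
                    ∑ (suc (length F)) (λ o → fresh (p + o)) ≢ 0
  lz-phrase-fresh {p} {F} p+ℓ≤n isLZ ∑≡0 = absurd isLZ
    where
    ℓ = length F
    copied : ∀ {o} → o < suc ℓ → Copied (p + o)
    copied {o} o< = fresh≡0⇒copied (n≤0⇒n≡0 (subst (fresh (p + o) ≤_) ∑≡0 (∑-term (λ o → fresh (p + o)) o<)))
    w≤p : w ≤ p
    w≤p = subst (w ≤_) (+-identityʳ p) (proj₁ (copied (s≤s z≤n)))
    q = p ∸ w
    q<p : q < p
    q<p = ∸-monoʳ-< (s≤s z≤n) w≤p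
    p+ℓ<n : p + ℓ < n α
    p+ℓ<n = copied⇒<n p+ℓ≤n (copied ≤-refl)
    same : ∀ {o} → o < suc ℓ → S α ‼ (q + o) ≡ S α ‼ (p + o)
    same {o} o< = trans (cong (S α ‼_) (sym (+-∸-comm o w≤p))) (sym (proj₂ (copied o<)))
    G = substring (S α) p (suc ℓ)
    ∣G∣ : length G ≡ suc ℓ
    ∣G∣ = trans (length-take (suc ℓ) (drop p (S α))) (m≤n⇒m⊓n≡m (subst (suc ℓ ≤_) (sym (length-drop p (S α)))
            (m+n≤o⇒m≤o∸n (suc ℓ) (subst (λ x → suc x ≤ n α) (+-comm p ℓ) p+ℓ<n))))
    G-at-p : OccursAt (S α) G p
    G-at-p = cong (substring (S α) p) ∣G∣
    G-at-q : OccursAt (S α) G q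
    G-at-q = trans (cong (substring (S α) q) ∣G∣) (substring-ext {S α} {q} {p} (suc ℓ) same)
    absurd : ¬ IsLZPhrase (S α) p F
    absurd (inj₁ (first , _)) = first (‼⇒occursBefore q<p
      (subst₂ (λ x y → S α ‼ x ≡ S α ‼ y) (+-identityʳ q) (+-identityʳ p) (same (s≤s z≤n)))
      (≤-<-trans (m≤m+n p ℓ) p+ℓ<n))
    absurd (inj₂ (_ , lz)) = <⇒≱ ≤-refl (subst (_≤ ℓ) ∣G∣
      (IsLongestPrevious.longest lz G G-at-p (q , q<p , G-at-q)))

  -- The factor 2: a fresh position lies in one phrase and may also be the
  -- position right after another.
  rank : ℕ → ℕ
  rank p = 2 * ∑ p fresh + fresh p

  rank-increases : ∀ {p F} → 0 < length F → p + length F ≤ n α → IsLZPhrase (S α) p F →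
                   rank p < rank (p + length F)
  rank-increases {p} {F} 0<ℓ p+ℓ≤n isLZ = begin-strict
    2 * ∑ p fresh + fresh p           <⟨ +-monoʳ-< (2 * ∑ p fresh) (fresh-p< X Y fresh-p≤X refl) ⟩
    2 * ∑ p fresh + (2 * X + Y)       ≡⟨ rearrange (∑ p fresh) X Y ⟩
    2 * (∑ p fresh + X) + Y           ≡⟨ cong (λ s → 2 * s + Y) (∑-++ p ℓ fresh) ⟨
    rank (p + ℓ)                      ∎
    where
    open ≤-Reasoning hiding (start)
    ℓ = length F
    X = ∑ ℓ (λ o → fresh (p + o))
    Y = fresh (p + ℓ)
    rearrange : ∀ s x y → 2 * s + (2 * x + y) ≡ 2 * (s + x) + y
    rearrange = solve-∀
    fresh-p≤X : fresh p ≤ X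
    fresh-p≤X = subst (λ x → fresh x ≤ X) (+-identityʳ p) (∑-term (λ o → fresh (p + o)) 0<ℓ)
    -- Stated for variables so that `X` can be split. If `X` is zero, then `p` is not fresh and the
    -- position after the phrase must be; otherwise `2 * X ≥ 2` exceeds `fresh p`.
    fresh-p< : ∀ x y → fresh p ≤ x → x + y ≡ X + Y → fresh p < 2 * x + y
    fresh-p< zero    zero    _  eq = contradiction (sym eq) (lz-phrase-fresh {p} {F} p+ℓ≤n isLZ)
    fresh-p< zero    (suc y) ≤0 _  = s≤s (≤-trans ≤0 z≤n)
    fresh-p< (suc x) y       _  _  = begin-strict
      fresh p               ≤⟨ fresh≤1 p ⟩
      1                     <⟨ s≤s (s≤s z≤n) ⟩
      2                     ≤⟨ *-monoʳ-≤ 2 (s≤s (z≤n {x})) ⟩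
      2 * suc x             ≤⟨ m≤m+n (2 * suc x) y ⟩
      2 * suc x + y         ∎

  copied-suc : ∀ {t} i → S α ‼ pos α (suc t) i ≡ S α ‼ pos α t i → Copied (pos α (suc t) i)
  copied-suc {t} i eq = ≤-trans (m≤m+n w (t * w)) (m≤m+n (suc t * w) i) ,
    trans eq (cong (S α ‼_) (sym (trans (cong (_∸ w) (+-assoc w (t * w) i)) (m+n∸m≡n w (t * w + i)))))

  fresh-column : ∀ {t i} → suc t < blocks α → i < m → fresh (pos α (suc t) i) ≢ 0 → rev α i ≡ suc t
  fresh-column {t} {i} t< i<m ≢0 with <-cmp (rev α i) (suc t)
  ... | tri≈ _ eq _   = eq
  ... | tri< rev< _ _ = contradiction
          (copied-suc {t} i (trans (S‼-𝚊 α t< i<m (<⇒≤ rev<)) (sym (S‼-𝚊 α (<-trans ≤-refl t<) i<m (s≤s⁻¹ rev<)))))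
          (when≢0 (¬? (copied? (pos α (suc t) i))) ≢0)
  ... | tri> _ _ <rev = contradiction
          (copied-suc {t} i (trans (S‼-𝚋 α t< i<m <rev) (sym (S‼-𝚋 α (<-trans ≤-refl t<) i<m (<-trans ≤-refl <rev)))))
          (when≢0 (¬? (copied? (pos α (suc t) i))) ≢0)

  -- After block 0, a block has at most one fresh column, that of the letter first occurring in it,
  -- besides its `$`.
  fresh-block : ∀ {t} → t < blocks α → ∑ w (λ i → fresh (pos α t i)) ≤ when (t ≟ 0) w + 2
  fresh-block {zero}  _  = ≤-trans (∑-mono w (λ {i} _ → fresh≤1 (pos α 0 i)))
                             (≤-trans (≤-reflexive (trans (∑-const w 1) (*-identityʳ w))) (m≤m+n w 2))
  fresh-block {suc t} t< = +-mono-≤ one (fresh≤1 (pos α (suc t) m))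
    where
    one : ∑ m (λ i → fresh (pos α (suc t) i)) ≤ 1
    one = ∑-subsingleton m _ (λ {i} _ → fresh≤1 (pos α (suc t) i)) (λ {i} {j} i<m j<m ≢0 ≢0′ →
      rev-injective α (<-≤-trans i<m (m≤n+m m j)) (<-≤-trans j<m (m≤n+m m i))
        (trans (fresh-column t< i<m ≢0) (sym (fresh-column t< j<m ≢0′))))

  ∑-fresh≤ : ∑ (n α) fresh ≤ 3 * m
  ∑-fresh≤ = begin
    ∑ (n α) fresh                                             ≡⟨ cong (λ k → ∑ k fresh) (n≡ α) ⟩
    ∑ (blocks α * w) fresh                                    ≡⟨ ∑-blocks (blocks α) w fresh ⟩
    ∑ (blocks α) (λ t → ∑ w (λ i → fresh (pos α t i)))        ≤⟨ ∑-mono (blocks α) fresh-block ⟩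
    ∑ (blocks α) (λ t → when (t ≟ 0) w + 2)                   ≡⟨ ∑-+ (blocks α) (λ t → when (t ≟ 0) w) (λ _ → 2) ⟩
    ∑ (blocks α) (λ t → when (t ≟ 0) w) + ∑ (blocks α) (λ _ → 2) ≤⟨ +-mono-≤ first-block (≤-reflexive (∑-const (blocks α) 2)) ⟩
    w + blocks α * 2                                          ≤⟨ n≤1+n _ ⟩
    suc (w + blocks α * 2)                                    ≡⟨ rearrange m (blocks α) ⟩
    m + suc (blocks α) * 2                                    ≡⟨ cong (λ x → m + x * 2) (suc-blocks α) ⟩
    m + m * 2                                                 ≡⟨ thrice m ⟩
    3 * m                                                     ∎
    where
    open ≤-Reasoning hiding (start)
    first-block : ∑ (blocks α) (λ t → when (t ≟ 0) w) ≤ w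
    first-block = ∑-subsingleton (blocks α) _ (λ {t} _ → when≤ (t ≟ 0) w)
      (λ {s} {t} _ _ ≢0 ≢0′ → trans (when≢0 (s ≟ 0) ≢0) (sym (when≢0 (t ≟ 0) ≢0′)))
    rearrange : ∀ m b → 1 + (1 + m + b * 2) ≡ m + (1 + b) * 2
    rearrange = solve-∀
    thrice : ∀ m → m + m * 2 ≡ 3 * m
    thrice = solve-∀

  -- Each phrase raises `rank` by at least one, so the number of phrases is at most the final rank.
  lz-size≤ : ∀ {Fs} → IsLZ (S α) Fs → length Fs ≤ 7 * m
  lz-size≤ {Fs} ((nonempty , concat≡) , isLZ) = begin
    length Fs                     ≤⟨ m≤m+n (length Fs) (rank 0) ⟩
    length Fs + rank 0            ≤⟨ length-phrases≤ rank Fs 0 increases ⟩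
    rank (length (concat Fs))     ≡⟨ cong (rank ∘ length) concat≡ ⟩
    2 * ∑ (n α) fresh + fresh (n α) ≤⟨ +-mono-≤ (*-monoʳ-≤ 2 ∑-fresh≤) (≤-trans (fresh≤1 (n α)) (m^n>0 2 α)) ⟩
    2 * (3 * m) + m               ≡⟨ rearrange m ⟩
    7 * m                         ∎
    where
    open ≤-Reasoning hiding (start)
    rearrange : ∀ m → 2 * (3 * m) + m ≡ 7 * m
    rearrange = solve-∀
    increases : ∀ j → rank (start Fs j) < rank (start Fs j + length (lookup Fs j))
    increases j = rank-increases (0<length-phrase nonempty j)
      (subst (start Fs j + length (lookup Fs j) ≤_) (cong length concat≡) (start+length≤ {Fs} j)) (isLZ j)

  z≤ : z (S α) ≤ 7 * m
  z≤ = lz-size≤ (proj₂ (lz-exists (S α)))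

-- Transitions and depths in an encoding.

fold-shift : ∀ {A : Set} (z : A) s k → fold z s (suc k) ≡ fold (s z) s k
fold-shift z s zero    = refl
fold-shift z s (suc k) = cong s (fold-shift z s k)

-- Phrases are numbered by `Fin f` in an encoding but by naturals in `Charging`; the default 0 fills
-- the rest.
extend : ∀ {f} → (Fin f → ℕ) → ℕ → ℕ
extend {zero}  g _       = 0
extend {suc f} g zero    = g zero
extend {suc f} g (suc j) = extend (g ∘ suc) j

extend-toℕ : ∀ {f} (g : Fin f → ℕ) j → extend g (toℕ j) ≡ g j
extend-toℕ g zero    = refl
extend-toℕ g (suc j) = extend-toℕ (g ∘ suc) j

phrase-exists : ∀ Fs {p} → p < length (concat Fs) → ∃ (InPhrase Fs p)
phrase-exists (F ∷ Fs) {p} p< with p <? length F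
... | yes p<F = zero , z≤n , p<F
... | no p≮F with phrase-exists Fs {p ∸ length F} (+-cancelˡ-< (length F) _ _
                    (subst₂ _<_ (sym (m+[n∸m]≡n (≮⇒≥ p≮F))) (length-++ F) p<))
...   | j , ≤p , p<′ = suc j ,
    subst (length F + start Fs j ≤_) (m+[n∸m]≡n (≮⇒≥ p≮F)) (+-monoʳ-≤ (length F) ≤p) ,
    subst₂ _<_ (m+[n∸m]≡n (≮⇒≥ p≮F)) (sym (+-assoc (length F) (start Fs j) _)) (+-monoʳ-< (length F) p<′)

follow≡ : ∀ {b} (s : Fin b) p → p ∸ b < b ∸ toℕ s → follow (just s) p ≡ just (toℕ s + (p ∸ b))
follow≡ {b} s p o< = cong (λ r → just (toℕ s + r)) (m<n⇒m%n≡m o<)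
  where instance _ = >-nonZero (m<n⇒0<n∸m (Fin.toℕ<n s))

module _ {Fs : List (List Letter)} {source : Sources Fs} where

  depth-step : ∀ {p q} → τ Fs source (just p) ≡ just q → depth Fs source q < depth Fs source p
  depth-step {p} {q} τ≡ with depth-exists Fs source p | depth-exists Fs source q
  ... | zero  , vanishes , _ | _ = contradiction (trans (sym τ≡) vanishes) λ ()
  ... | suc k , vanishes , _ | _ , _ , minimal = s≤s (minimal (begin
      fold (just q) (τ Fs source) (suc k)                 ≡⟨ cong (λ x → fold x (τ Fs source) (suc k)) τ≡ ⟨
      fold (τ Fs source (just p)) (τ Fs source) (suc k)   ≡⟨ fold-shift (just p) (τ Fs source) (suc k) ⟨
      fold (just p) (τ Fs source) (suc (suc k))           ≡⟨ vanishes ⟩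
      nothing                                             ∎))
    where open ≡-Reasoning

  depth≤height : ∀ {p} → p < length (concat Fs) → depth Fs source p ≤ heightOf Fs source
  depth≤height p< = All.lookup (xs≤max 0 _) (∈-map⁺ (depth Fs source) (∈-upTo⁺ p<))

-- Phrases of an encoding as blocks, columns and jumps.

module FromEncoding {β : ℕ} (E : Encoding (S (suc β))) where

  open Encoding E
  open ≤-Reasoning hiding (start)

  private
    α = suc β
    m = 2 ^ α
    w = width α
    T = S α
    Fs = phrases
    f = length Fs

    concat≡ : concat Fs ≡ T
    concat≡ = proj₂ (proj₁ isLZLike)

    b ℓ : Fin f → ℕ
    b = start Fs
    ℓ j = length (lookup Fs j)

  phrase-‼ : ∀ j {o} → o < ℓ j → T ‼ (b j + o) ≡ lookup Fs j ‼ o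
  phrase-‼ j = occursAt⇒‼ {T} {lookup Fs j} {b j} (phrase-occurs (proj₁ isLZLike) j)

  source-‼ : ∀ j {s} → source j ≡ just s → ∀ {o} → o < ℓ j → T ‼ (toℕ s + o) ≡ T ‼ (b j + o)
  source-‼ j {s} src≡ o< = trans (occursAt⇒‼ {T} {lookup Fs j} {toℕ s} occ o<) (sym (phrase-‼ j o<))
    where
    occ : OccursAt T (lookup Fs j) (toℕ s)
    occ = subst (IsSource T (b j) (lookup Fs j)) src≡ (isSource j)

  -- A phrase without a source contains some leftmost occurrence `q`. If it has length 1, then `q`
  -- is `p`, whose character occurs earlier at `p′`; otherwise the whole phrase occurs earlier, and
  -- the character at `q` with it.
  has-source : ∀ {p p′} j → InPhrase Fs p j → p′ < p → T ‼ p′ ≡ T ‼ p → ∃[ s ] source j ≡ just s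
  has-source {p} {p′} j (b≤p , p<b+ℓ) p′<p same with source j | isSource j
  ... | just s  | _ = s , refl
  ... | nothing | q , q<b+ℓ , b≤q , leftmost = contradiction before leftmost
    where
    in-text : ∀ {r} → r < b j + ℓ j → r < length T
    in-text r< = subst (_ <_) (cong length concat≡) (<-≤-trans r< (start+length≤ {Fs} j))
    before : OccursBefore T (substring T q 1) q
    before with proj₂ isLZLike j
    ... | inj₁ ℓ≡1 = subst (λ r → OccursBefore T (substring T r 1) r) (trans (at-b b≤p p<b+ℓ) (sym (at-b b≤q q<b+ℓ)))
                       (‼⇒occursBefore p′<p same (in-text p<b+ℓ))
      where
      at-b : ∀ {r} → b j ≤ r → r < b j + ℓ j → r ≡ b j
      at-b {r} b≤r r< = ≤-antisym (s≤s⁻¹ (subst (r <_) (trans (cong (b j +_) ℓ≡1) (+-comm (b j) 1)) r<)) b≤r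
    ... | inj₂ (r , r<b , occ) = ‼⇒occursBefore (subst (r + (q ∸ b j) <_) q≡ (+-monoˡ-< (q ∸ b j) r<b))
                                   (trans (occursAt⇒‼ {T} {lookup Fs j} {r} occ o<) (trans (sym (phrase-‼ j o<)) (cong (T ‼_) q≡)))
                                   (in-text q<b+ℓ)
      where
      q≡ : b j + (q ∸ b j) ≡ q
      q≡ = m+[n∸m]≡n b≤q
      o< : q ∸ b j < ℓ j
      o< = +-cancelˡ-< (b j) _ _ (subst (_< b j + ℓ j) (sym q≡) q<b+ℓ)

  -- These values are meaningful only for phrases that hold a repeated `𝚊 i`: such a phrase stays in
  -- one block, and its distance to the source is a multiple of `w`.
  blockᶠ loᶠ hiᶠ jumpᶠ : Fin f → ℕ
  blockᶠ j = b j / w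
  loᶠ    j = b j % w
  hiᶠ    j = loᶠ j + ℓ j
  jumpᶠ  j = maybe′ (λ s → (b j ∸ toℕ s) / w) 0 (source j)

  block lo hi jump : ℕ → ℕ
  block = extend blockᶠ
  lo    = extend loᶠ
  hi    = extend hiᶠ
  jump  = extend jumpᶠ

  phraseAt : ℕ → ℕ
  phraseAt p with inPhrase? Fs p
  ... | yes (j , _) = toℕ j
  ... | no _        = 0

  -- A single inspection of `inPhrase?` makes `phraseAt` and `τ` refer to the same `j`.
  locate : ∀ {p} → p < length T → ∃[ j ] InPhrase Fs p j × phraseAt p ≡ toℕ j × τ Fs source (just p) ≡ follow (source j) p
  locate {p} p< with inPhrase? Fs p
  ... | yes (j , in-j) = j , in-j , refl , refl
  ... | no ∄j          = contradiction (phrase-exists Fs (subst (p <_) (sym (cong length concat≡)) p<)) ∄j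

  dep : ℕ → ℕ → ℕ
  dep t i = depth Fs source (pos α t i)

  module _ {t i} (t< : t < blocks α) (i<m : i < m) (rev<t : rev α i < t) where

    private
      p = pos α t i

    module _ (j : Fin f) (in-j : InPhrase Fs p j) (s : Fin (b j)) (src≡ : source j ≡ just s) where

      private
        bʲ = b j
        o  = p ∸ bʲ
        q  = toℕ s + o

        p≡ : bʲ + o ≡ p
        p≡ = m+[n∸m]≡n (proj₁ in-j)

        o<ℓ : o < ℓ j
        o<ℓ = +-cancelˡ-< bʲ _ _ (subst (_< bʲ + ℓ j) (sym p≡) (proj₂ in-j))

        q<p : q < p
        q<p = subst (q <_) p≡ (+-monoˡ-< o (Fin.toℕ<n s))

        -- Each `$` occurs once, so copying it would make the source position equal to the start of
        -- the phrase.
        no-$ : ∀ {t′} → t′ < blocks α → bʲ ≤ pos α t′ m → ¬ pos α t′ m < bʲ + ℓ j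
        no-$ {t′} t′< b≤ <b+ℓ = <⇒≢ (Fin.toℕ<n s) (+-cancelʳ-≡ (pos α t′ m ∸ bʲ) (toℕ s) bʲ (trans s≡ (sym $≡)))
          where
          $≡ : bʲ + (pos α t′ m ∸ bʲ) ≡ pos α t′ m
          $≡ = m+[n∸m]≡n b≤
          s≡ : toℕ s + (pos α t′ m ∸ bʲ) ≡ pos α t′ m
          s≡ = $-position α (trans
            (source-‼ j src≡ (+-cancelˡ-< bʲ _ _ (subst (_< bʲ + ℓ j) (sym $≡) <b+ℓ)))
            (trans (cong (T ‼_) $≡) (S‼-$ α t′<)))

        -- A phrase that starts in an earlier block would contain the `$` ending block `t - 1`.
        b≥ : t * w ≤ bʲ
        b≥ = ≮⇒≥ (λ b<tw → crosses t t< b<tw (proj₂ in-j))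
          where
          crosses : ∀ t → t < blocks α → bʲ < t * w → ¬ pos α t i < bʲ + ℓ j
          crosses (suc t′) t< (s≤s b≤) p< = no-$ {t′} (<-trans ≤-refl t<)
            (subst (bʲ ≤_) (+-comm m (t′ * w)) b≤)
            (<-trans (begin-strict
              t′ * w + m      ≡⟨ +-comm (t′ * w) m ⟩
              m + t′ * w      <⟨ ≤-refl ⟩
              suc t′ * w      ≤⟨ m≤m+n (suc t′ * w) i ⟩
              suc t′ * w + i  ∎) p<)

        end≤ : bʲ + ℓ j ≤ pos α t m
        end≤ = ≮⇒≥ (no-$ t< (≤-trans (proj₁ in-j) (+-monoʳ-≤ (t * w) (<⇒≤ i<m))))

        c = bʲ ∸ t * w

        b≡ : t * w + c ≡ bʲ
        b≡ = m+[n∸m]≡n b≥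

        c≤i : c ≤ i
        c≤i = +-cancelˡ-≤ (t * w) c i (subst (_≤ p) (sym b≡) (proj₁ in-j))

        c<w : c < w
        c<w = s≤s (≤-trans c≤i (<⇒≤ i<m))

        end≡ : t * w + (c + ℓ j) ≡ bʲ + ℓ j
        end≡ = trans (sym (+-assoc (t * w) c (ℓ j))) (cong (_+ ℓ j) b≡)

        block≡t : blockᶠ j ≡ t
        block≡t = trans (cong (_/ w) (sym b≡)) ([q*n+r]/n≡q t c<w)

        lo≡c : loᶠ j ≡ c
        lo≡c = trans (cong (_% w) (sym b≡)) ([q*n+r]%n≡r t c<w)

        hi≡ : hiᶠ j ≡ c + ℓ j
        hi≡ = cong (_+ ℓ j) lo≡c

        hi≤m : c + ℓ j ≤ m
        hi≤m = +-cancelˡ-≤ (t * w) _ _ (subst (_≤ pos α t m) (sym end≡) end≤)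

        source-column : ∃[ t′ ] t′ < blocks α × i < m × rev α i ≤ t′ × q ≡ pos α t′ i
        source-column = 𝚊-position α (trans (source-‼ j src≡ o<ℓ) (trans (cong (T ‼_) p≡) (S‼-𝚊 α t< i<m (<⇒≤ rev<t))))

        t′ = proj₁ source-column
        rev≤t′ : rev α i ≤ t′
        rev≤t′ = proj₁ (proj₂ (proj₂ (proj₂ source-column)))
        q≡ : q ≡ pos α t′ i
        q≡ = proj₂ (proj₂ (proj₂ (proj₂ source-column)))

        t′<t : t′ < t
        t′<t = *-cancelʳ-< w t′ t (+-cancelʳ-< i _ _ (subst (_< p) q≡ q<p))

        d = t ∸ t′

        d+t′≡ : d + t′ ≡ t
        d+t′≡ = m∸n+n≡m (<⇒≤ t′<t)

        -- The phrase and its source share the offset `o`, so the shift between the two occurrences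
        -- of `𝚊 i` is also the shift between their starts.
        b≡s+ : bʲ ≡ d * w + toℕ s
        b≡s+ = +-cancelʳ-≡ o bʲ (d * w + toℕ s) (begin-equality
          bʲ + o                    ≡⟨ p≡ ⟩
          t * w + i                 ≡⟨ cong (λ x → x * w + i) d+t′≡ ⟨
          (d + t′) * w + i          ≡⟨ rearrange d t′ w i ⟩
          d * w + (t′ * w + i)      ≡⟨ cong (d * w +_) q≡ ⟨
          d * w + (toℕ s + o)       ≡⟨ +-assoc (d * w) (toℕ s) o ⟨
          d * w + toℕ s + o         ∎)
          where
          rearrange : ∀ d t w i → (d + t) * w + i ≡ d * w + (t * w + i)
          rearrange = solve-∀

        b∸s≡ : bʲ ∸ toℕ s ≡ d * w
        b∸s≡ = trans (cong (_∸ toℕ s) b≡s+) (m+n∸n≡m (d * w) (toℕ s))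

        jump≡d : jumpᶠ j ≡ d
        jump≡d = trans (cong (maybe′ (λ s → (b j ∸ toℕ s) / w) 0) src≡)
                       (trans (cong (_/ w) b∸s≡) (m*n/n≡m d w))

        0<d : 0 < d
        0<d = m<n⇒0<n∸m t′<t

        s≡ : toℕ s ≡ t′ * w + c
        s≡ = +-cancelˡ-≡ (d * w) (toℕ s) (t′ * w + c) (begin-equality
          d * w + toℕ s             ≡⟨ b≡s+ ⟨
          bʲ                        ≡⟨ b≡ ⟨
          t * w + c                 ≡⟨ cong (λ x → x * w + c) d+t′≡ ⟨
          (d + t′) * w + c          ≡⟨ rearrange d t′ w c ⟩
          d * w + (t′ * w + c)      ∎)
          where
          rearrange : ∀ d t w i → (d + t) * w + i ≡ d * w + (t * w + i)
          rearrange = solve-∀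

        -- The period is at least one whole block and the offset stays within a block, so the
        -- reduction modulo the period in `follow` has no effect.
        o<period : o < bʲ ∸ toℕ s
        o<period = begin-strict
          o               ≤⟨ +-cancelˡ-≤ (t * w) o i (≤-trans (+-monoˡ-≤ o b≥) (≤-reflexive p≡)) ⟩
          i               <⟨ m≤n⇒m≤1+n i<m ⟩
          w               ≤⟨ m≤n*m w d ⦃ >-nonZero 0<d ⦄ ⟩
          d * w           ≡⟨ b∸s≡ ⟨
          bʲ ∸ toℕ s      ∎

        -- The source shows `𝚊 c′` in block `t′`, and by `𝚊-position` this happens only from block
        -- `rev α c′` on.
        copied : ∀ {c′} → c ≤ c′ → c′ < c + ℓ j → rev α c′ ≤ t → rev α c′ ≤ t′
        copied {c′} c≤c′ c′< rev≤t with 𝚊-position α at-source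
          where
          x = c′ ∸ c
          c+x≡ : c + x ≡ c′
          c+x≡ = m+[n∸m]≡n c≤c′
          b+x≡ : bʲ + x ≡ pos α t c′
          b+x≡ = trans (cong (_+ x) (sym b≡)) (trans (+-assoc (t * w) c x) (cong (t * w +_) c+x≡))
          s+x≡ : toℕ s + x ≡ pos α t′ c′
          s+x≡ = trans (cong (_+ x) s≡) (trans (+-assoc (t′ * w) c x) (cong (t′ * w +_) c+x≡))
          at-source : T ‼ pos α t′ c′ ≡ just (𝚊 c′)
          at-source = trans (cong (T ‼_) (sym s+x≡)) (trans
            (source-‼ j src≡ (+-cancelˡ-< c _ _ (subst (_< c + ℓ j) (sym c+x≡) c′<)))
            (trans (cong (T ‼_) b+x≡) (S‼-𝚊 α t< (<-≤-trans c′< hi≤m) rev≤t)))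
        ... | t″ , _ , c′<m , rev≤t″ , pos≡ =
          subst (rev α c′ ≤_) (sym (proj₁ (pos-injective α (m≤n⇒m≤1+n c′<m) (m≤n⇒m≤1+n c′<m) pos≡))) rev≤t″

      module _ {h : ℕ} (τ≡ : τ Fs source (just p) ≡ follow (source j) p) where

        open Charging β f h block jump lo hi dep

        covers : Covers t i (toℕ j)
        covers = record
          { j<f    = Fin.toℕ<n j
          ; block≡ = trans (extend-toℕ blockᶠ j) block≡t
          ; lo≤    = subst (_≤ i) (sym lo≡) c≤i
          ; <hi    = subst (i <_) (sym hi≡′) (+-cancelˡ-< (t * w) i _ (subst (p <_) (sym end≡) (proj₂ in-j)))
          ; 0<jump = subst (0 <_) (sym jump≡) 0<d
          ; jump≤  = subst (λ x → x + rev α i ≤ t) (sym jump≡) (≤-trans (+-monoʳ-≤ d rev≤t′) (≤-reflexive d+t′≡))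
          ; dep<   = subst (λ x → dep x i < dep t i) (sym (trans (cong (t ∸_) jump≡) (m∸[m∸n]≡n (<⇒≤ t′<t))))
                       (depth-step {Fs} {source} {p} {pos α t′ i} (trans τ≡ (trans (cong (λ x → follow x p) src≡)
                         (trans (follow≡ s p o<period) (cong just q≡)))))
          ; copies = λ {c′} lo≤ <hi rev≤t → subst (λ x → rev α c′ + x ≤ t) (sym jump≡)
                       (≤-trans (+-monoˡ-≤ d (copied (subst (_≤ c′) lo≡ lo≤) (subst (c′ <_) hi≡′ <hi) rev≤t))
                                (≤-reflexive (trans (+-comm t′ d) d+t′≡)))
          }
          where
          lo≡ : lo (toℕ j) ≡ c
          lo≡ = trans (extend-toℕ loᶠ j) lo≡c
          hi≡′ : hi (toℕ j) ≡ c + ℓ j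
          hi≡′ = trans (extend-toℕ hiᶠ j) hi≡
          jump≡ : jump (toℕ j) ≡ d
          jump≡ = trans (extend-toℕ jumpᶠ j) jump≡d

-- The lower bound for a single encoding.

size-bound : ∀ {β h} H σ (E : Encoding (S (suc β))) → height E ≤ h → 1 ≤ h → 4 * h ≤ H → H ^ σ ≤ 2 ^ β →
             σ * 2 ^ β ≤ 16 * size E
size-bound {β} {h} H σ E height≤h = all-scales dep≤h (λ t i → phraseAt (pos α t i)) covered H σ
  where
  α = suc β
  open Encoding E using (phrases; source; isLZLike)
  open FromEncoding {β} E
  open Charging β (length phrases) h block jump lo hi dep
  in-text : ∀ {t} → suc t < 2 ^ α → t < blocks α
  in-text {t} t< = s≤s⁻¹ (subst (suc t <_) (sym (suc-blocks α)) t<)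
  dep≤h : ∀ {t i} → i < 2 ^ α → rev α i ≤ t → suc t < 2 ^ α → dep t i ≤ h
  dep≤h {t} {i} i<m _ t< = ≤-trans (depth≤height {phrases} {source} {pos α t i}
    (subst (λ T → pos α t i < length T) (sym (proj₂ (proj₁ isLZLike))) (pos< α (in-text t<) (m≤n⇒m≤1+n i<m)))) height≤h
  covered : ∀ {t i} → i < 2 ^ α → rev α i < t → suc t < 2 ^ α → Covers t i (phraseAt (pos α t i))
  covered {suc t} {i} i<m rev<t t< with locate (pos< α (in-text t<) (m≤n⇒m≤1+n i<m))
  -- Since `rev α i < suc t`, block `t` directly above shows the same letter, so the phrase cannot
  -- lack a source.
  ... | j , in-j , phrase≡ , τ≡ with has-source j in-j (+-monoˡ-< i (m<n+m (t * width α) (s≤s z≤n)))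
            (trans (S‼-𝚊 α (<-trans ≤-refl (in-text t<)) i<m (s≤s⁻¹ rev<t)) (sym (S‼-𝚊 α (in-text t<) i<m (<⇒≤ rev<t))))
  ...   | s , src≡ = subst (Covers (suc t) i) (sym phrase≡) (covers (in-text t<) i<m rev<t j in-j s src≡ τ≡)

-- Logarithms and the asymptotic statements.

m<2^m : ∀ m → m < 2 ^ m
m<2^m zero    = s≤s z≤n
m<2^m (suc m) = +-mono-≤ (m^n>0 2 m) (≤-trans (m<2^m m) (≤-reflexive (sym (+-identityʳ (2 ^ m)))))

m<2^[1+⌊log₂m⌋] : ∀ m → m < 2 ^ suc ⌊log₂ m ⌋
m<2^[1+⌊log₂m⌋] m = ≰⇒> λ 2^≤m →
  <⇒≱ ≤-refl (subst (_≤ ⌊log₂ m ⌋) (⌊log₂[2^n]⌋≡n (suc ⌊log₂ m ⌋)) (⌊log₂⌋-mono-≤ 2^≤m))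

m≤2^k⇒⌊log₂m⌋≤k : ∀ {m} k → m ≤ 2 ^ k → ⌊log₂ m ⌋ ≤ k
m≤2^k⇒⌊log₂m⌋≤k {m} k m≤ = subst (⌊log₂ m ⌋ ≤_) (⌊log₂[2^n]⌋≡n k) (⌊log₂⌋-mono-≤ m≤)

-- Gives `K * loglog[n] α < α` for large `α`. At the base `2 ^ B = 64 * (2 ^ K) ^ 2` exceeds the
-- left side, and each further step at most doubles the left side.
K*[2+e]<2^e : ∀ K {e} → 6 + (K + K) ≤ e → K * (2 + e) < 2 ^ e
K*[2+e]<2^e K {e} B≤e = subst (λ x → K * (2 + x) < 2 ^ x) (m∸n+n≡m B≤e) (go (e ∸ B))
  where
  open ≤-Reasoning
  B = 6 + (K + K)
  go : ∀ x → K * (2 + (x + B)) < 2 ^ (x + B)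
  go zero = begin-strict
    -- The added polynomial is the difference to `64 * (1 + K) ^ 2`.
    K * (2 + B)                                           <⟨ m<m+n (K * (2 + B)) {62 * (K * K) + 120 * K + 64} (≤-trans (s≤s z≤n) (m≤n+m 64 (62 * (K * K) + 120 * K))) ⟩
    K * (2 + B) + (62 * (K * K) + 120 * K + 64)           ≡⟨ square K ⟩
    64 * (suc K * suc K)                                  ≤⟨ *-monoʳ-≤ 64 (*-mono-≤ (m<2^m K) (m<2^m K)) ⟩
    64 * (2 ^ K * 2 ^ K)                                  ≡⟨ cong (64 *_) (^-distribˡ-+-* 2 K K) ⟨
    64 * 2 ^ (K + K)                                      ≡⟨ ^-distribˡ-+-* 2 6 (K + K) ⟨
    2 ^ B                                                 ∎
    where
    square : ∀ K → K * (2 + (6 + (K + K))) + (62 * (K * K) + 120 * K + 64) ≡ 64 * ((1 + K) * (1 + K))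
    square = solve-∀
  go (suc x) = begin-strict
    K * suc (2 + (x + B))                 ≡⟨ *-suc K (2 + (x + B)) ⟩
    K + K * (2 + (x + B))                 ≤⟨ +-monoˡ-≤ _ (m≤m*n K (2 + (x + B))) ⟩
    K * (2 + (x + B)) + K * (2 + (x + B)) <⟨ +-mono-< (go x) (go x) ⟩
    2 ^ (x + B) + 2 ^ (x + B)             ≡⟨ cong (2 ^ (x + B) +_) (+-identityʳ _) ⟨
    2 ^ suc (x + B)                       ∎

-- With `H = 2 ^ η`, exactly the `β / η` scales whose exponents fit below `β` are used.
encoding-lower : ∀ {β} h .⦃ _ : NonZero h ⦄ η .⦃ _ : NonZero η ⦄ → 4 * h ≤ 2 ^ η →
                 ∀ {f} → IsSizeWithin h (S (suc β)) f → β / η * 2 ^ β ≤ 16 * f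
encoding-lower {β} h η 4h≤ (E , ≤h , refl) = size-bound {β} {h} (2 ^ η) (β / η) E ≤h (>-nonZero⁻¹ h) 4h≤ (begin
    (2 ^ η) ^ (β / η)   ≡⟨ ^-*-assoc 2 η (β / η) ⟩
    2 ^ (η * (β / η))   ≡⟨ cong (2 ^_) (*-comm η (β / η)) ⟩
    2 ^ (β / η * η)     ≤⟨ ^-monoʳ-≤ 2 (m/n*n≤m β η) ⟩
    2 ^ β               ∎)
  where open ≤-Reasoning

ẑ-lower : ∀ {β} h .⦃ _ : NonZero h ⦄ η .⦃ _ : NonZero η ⦄ → 4 * h ≤ 2 ^ η →
          β / η * 2 ^ β ≤ 16 * ẑ h (S (suc β))
ẑ-lower {β} h η 4h≤ = encoding-lower {β} h η 4h≤ {ẑ h (S (suc β))} (proj₁ (proj₂ (ẑ-exists h (S (suc β)))))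

z-upper : ∀ β → z (S (suc β)) ≤ 14 * 2 ^ β
z-upper β = ≤-trans (z≤ (suc β)) (≤-reflexive (sym (*-assoc 7 2 (2 ^ β))))

n≤2^ : ∀ α → n α ≤ 2 ^ (2 * α)
n≤2^ α = begin
  n α             ≡⟨ n≡m²∸1 α ⟩
  (2 ^ α) ^ 2 ∸ 1 ≤⟨ m∸n≤m _ 1 ⟩
  (2 ^ α) ^ 2     ≡⟨ ^-*-assoc 2 α 2 ⟩
  2 ^ (α * 2)     ≡⟨ cong (2 ^_) (*-comm α 2) ⟩
  2 ^ (2 * α)     ∎
  where open ≤-Reasoning

log[n]≤ : ∀ α → log[n] α ≤ 2 * α
log[n]≤ α = m≤2^k⇒⌊log₂m⌋≤k (2 * α) (n≤2^ α)

1≤loglog[n] : ∀ {α} → 3 ≤ α → 1 ≤ loglog[n] α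
1≤loglog[n] {α} 3≤α = ⌊log₂⌋-mono-≤ {2} (⌊log₂⌋-mono-≤ {4} (begin
  4                         ≤⟨ s≤s (s≤s (s≤s (s≤s z≤n))) ⟩
  7                         ≤⟨ s≤s⁻¹ (subst (8 ≤_) (sym (suc-blocks α)) (^-monoʳ-≤ 2 3≤α)) ⟩
  blocks α                  ≤⟨ m≤m*n (blocks α) (width α) ⟩
  blocks α * width α        ≡⟨ n≡ α ⟨
  n α                       ∎))
  where open ≤-Reasoning

polylog⇒ratio : (h : ℕ → ℕ) ⦃ _ : ∀ {k} → NonZero (h k) ⦄ →
  (λ α → h (n α)) ∈O[polylog-n] →
  (λ α → ẑ (h (n α)) (S α)) / (λ α → z (S α)) ∈Ω log[n] / loglog[n]
-- The threshold on `α` makes `η ≤ β`, so there is at least one scale and `α ≤ 2 * σ * η`. The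
-- constant is `56 * 16`, where `56 = 4 * 14`.
polylog⇒ratio h (k , C , N , h≤) = 896 * K , N ⊔ 2 ^ (6 + (K + K)) , bound
  where
  open ≤-Reasoning
  -- Chosen so that `4 * h (n α) ≤ 2 ^ (K * loglog[n] α)`: the exponent needed is
  -- `2 + C + (1 + X) * k`, and `X ≥ 1`.
  K = 2 + C + (k + k)
  bound : ∀ α → 3 ≤ α → N ⊔ 2 ^ (6 + (K + K)) ≤ α →
          log[n] α * z (S α) ≤ 896 * K * (ẑ (h (n α)) (S α) * loglog[n] α)
  bound (suc β) 3≤α N≤α = begin
    log[n] α * z (S α)                ≤⟨ *-mono-≤ (≤-trans (log[n]≤ α) (*-monoʳ-≤ 2 α≤)) (z-upper β) ⟩
    2 * (σ * η + σ * η) * (14 * 2 ^ β) ≡⟨ rearrange₁ σ η (2 ^ β) ⟩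
    56 * η * (σ * 2 ^ β)              ≤⟨ *-monoʳ-≤ (56 * η) (ẑ-lower {β} (h (n α)) η 4h≤) ⟩
    56 * (K * X) * (16 * ẑ (h (n α)) (S α)) ≡⟨ rearrange₂ K X (ẑ (h (n α)) (S α)) ⟩
    896 * K * (ẑ (h (n α)) (S α) * X) ∎
    where
    α = suc β
    L = log[n] α
    X = loglog[n] α
    η = K * X
    1≤X : 1 ≤ X
    1≤X = 1≤loglog[n] 3≤α
    instance
      X≢0 : NonZero X
      X≢0 = >-nonZero 1≤X
      η≢0 : NonZero η
      η≢0 = m*n≢0 K X
    σ = β / η
    rearrange₁ : ∀ σ η M → 2 * (σ * η + σ * η) * (14 * M) ≡ 56 * η * (σ * M)
    rearrange₁ = solve-∀
    rearrange₂ : ∀ K X f → 56 * (K * X) * (16 * f) ≡ 896 * K * (f * X)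
    rearrange₂ = solve-∀
    4h≤ : 4 * h (n α) ≤ 2 ^ η
    4h≤ = begin
      4 * h (n α)                         ≤⟨ *-monoʳ-≤ 4 (h≤ α 3≤α (≤-trans (m≤m⊔n N _) N≤α)) ⟩
      4 * (C * L ^ k)                     ≤⟨ *-monoʳ-≤ 4 (*-mono-≤ (<⇒≤ (m<2^m C)) (^-monoˡ-≤ k (<⇒≤ (m<2^[1+⌊log₂m⌋] L)))) ⟩
      4 * (2 ^ C * (2 ^ suc X) ^ k)       ≡⟨ cong (λ x → 4 * (2 ^ C * x)) (^-*-assoc 2 (suc X) k) ⟩
      4 * (2 ^ C * 2 ^ (suc X * k))       ≡⟨ cong (4 *_) (^-distribˡ-+-* 2 C (suc X * k)) ⟨
      2 ^ 2 * 2 ^ (C + suc X * k)         ≡⟨ ^-distribˡ-+-* 2 2 (C + suc X * k) ⟨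
      2 ^ (2 + (C + suc X * k))           ≤⟨ ^-monoʳ-≤ 2 exponent≤ ⟩
      2 ^ η                               ∎
      where
      exponent≤ : 2 + (C + suc X * k) ≤ K * X
      exponent≤ = begin
        2 + (C + suc X * k)               ≡⟨ rearrange C X k ⟩
        (2 + C + k) * 1 + k * X           ≤⟨ +-monoˡ-≤ (k * X) (*-monoʳ-≤ (2 + C + k) 1≤X) ⟩
        (2 + C + k) * X + k * X           ≡⟨ *-distribʳ-+ X (2 + C + k) k ⟨
        (2 + C + k + k) * X               ≡⟨ cong (_* X) (+-assoc (2 + C) k k) ⟩
        K * X                             ∎
        where
        rearrange : ∀ C X k → 2 + (C + (1 + X) * k) ≡ (2 + C + k) * 1 + k * X
        rearrange = solve-∀
    η≤β : η ≤ β
    η≤β with 2^-bracket β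
    ... | e , 2^e≤α , α<2^ = s≤s⁻¹ (begin-strict
        K * X             ≤⟨ *-monoʳ-≤ K (m≤2^k⇒⌊log₂m⌋≤k (2 + e) (≤-trans (log[n]≤ α) (*-monoʳ-≤ 2 (<⇒≤ α<2^)))) ⟩
        K * (2 + e)       <⟨ K*[2+e]<2^e K B≤e ⟩
        2 ^ e             ≤⟨ 2^e≤α ⟩
        α                 ∎)
      where
      B≤e : 6 + (K + K) ≤ e
      B≤e = ≮⇒≥ λ e<B → <⇒≱ (<-≤-trans α<2^ (^-monoʳ-≤ 2 e<B)) (≤-trans (m≤n⊔m N _) N≤α)
    α≤ : α ≤ σ * η + σ * η
    α≤ = begin
      α               ≤⟨ m<[1+m/n]*n β η ⟩
      η + σ * η       ≤⟨ +-monoˡ-≤ (σ * η) (m≤n*m η σ ⦃ >-nonZero (m≥n⇒m/n>0 η≤β) ⦄) ⟩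
      σ * η + σ * η   ∎

-- For `2 ^ e ≤ h < 2 ^ (1 + e)` the choice `η = 3 + e` is admissible. A linear `ẑ` then bounds the
-- number of scales `β / η` by `224 * C`, so `α` is at most a constant times `3 + e`, with `e` at
-- most the logarithm of `h`.
linear⇒polynomial : (h : ℕ → ℕ) ⦃ _ : ∀ {k} → NonZero (h k) ⦄ →
  (λ α → ẑ (h (n α)) (S α)) ∈O (λ α → z (S α)) → (λ α → h (n α)) ∈n^Ω[1]
linear⇒polynomial h (C , N , ẑ≤) = 8 * Q , N ⊔ suc (3 * Q) , bound
  where
  open ≤-Reasoning
  Q = suc (224 * C)
  bound : ∀ α → 3 ≤ α → N ⊔ suc (3 * Q) ≤ α → n α ≤ h (n α) ^ (8 * Q)
  bound (suc β) 3≤α N≤α = fromBracket (2^-bracket (pred hₙ))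
    where
    α = suc β
    hₙ = h (n α)
    byCases : ∀ e → 2 ^ e ≤ hₙ → α ≤ Q * (3 + e) → n α ≤ hₙ ^ (8 * Q)
    -- For `e = 0` a power of `h` need not grow; the threshold `α > 3 * Q` excludes this case.
    byCases zero    _     α≤ = contradiction (≤-trans (≤-trans (m≤n⊔m N _) N≤α) α≤)
                                 (λ lt → <⇒≱ lt (≤-reflexive (*-comm Q 3)))
    byCases (suc e) 2^e≤h α≤ = begin
      n α                         ≤⟨ n≤2^ α ⟩
      2 ^ (2 * α)                 ≤⟨ ^-monoʳ-≤ 2 exponent≤ ⟩
      2 ^ (suc e * (8 * Q))       ≡⟨ ^-*-assoc 2 (suc e) (8 * Q) ⟨
      (2 ^ suc e) ^ (8 * Q)       ≤⟨ ^-monoˡ-≤ (8 * Q) 2^e≤h ⟩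
      hₙ ^ (8 * Q)                ∎
      where
      exponent≤ : 2 * α ≤ suc e * (8 * Q)
      exponent≤ = begin
        2 * α                             ≤⟨ *-monoʳ-≤ 2 α≤ ⟩
        2 * (Q * (4 + e))                 ≤⟨ *-monoʳ-≤ 2 (*-monoʳ-≤ Q (+-monoʳ-≤ 4 (m≤n*m e 4))) ⟩
        2 * (Q * (4 + 4 * e))             ≡⟨ rearrange Q e ⟩
        suc e * (8 * Q)                   ∎
        where
        rearrange : ∀ Q e → 2 * (Q * (4 + 4 * e)) ≡ (1 + e) * (8 * Q)
        rearrange = solve-∀
    fromBracket : ∃[ e ] 2 ^ e ≤ suc (pred hₙ) × suc (pred hₙ) < 2 ^ suc e → n α ≤ hₙ ^ (8 * Q)
    fromBracket (e , 2^e≤ , <2^) = byCases e (subst (2 ^ e ≤_) (suc-pred hₙ) 2^e≤) α≤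
      where
      η = 3 + e
      4h≤ : 4 * hₙ ≤ 2 ^ η
      4h≤ = begin
        4 * hₙ            ≤⟨ *-monoʳ-≤ 4 (subst (_≤ 2 ^ suc e) (suc-pred hₙ) (<⇒≤ <2^)) ⟩
        4 * 2 ^ suc e     ≡⟨ ^-distribˡ-+-* 2 2 (suc e) ⟨
        2 ^ η             ∎
      σ≤ : β / η ≤ 224 * C
      σ≤ = *-cancelʳ-≤ (β / η) (224 * C) (2 ^ β) ⦃ m^n≢0 2 β ⦄ (begin
        β / η * 2 ^ β               ≤⟨ ẑ-lower {β} hₙ η 4h≤ ⟩
        16 * ẑ hₙ (S α)             ≤⟨ *-monoʳ-≤ 16 (ẑ≤ α 3≤α (≤-trans (m≤m⊔n N _) N≤α)) ⟩
        16 * (C * z (S α))          ≤⟨ *-monoʳ-≤ 16 (*-monoʳ-≤ C (z-upper β)) ⟩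
        16 * (C * (14 * 2 ^ β))     ≡⟨ rearrange C (2 ^ β) ⟩
        224 * C * 2 ^ β             ∎)
        where
        rearrange : ∀ C M → 16 * (C * (14 * M)) ≡ 224 * C * M
        rearrange = solve-∀
      α≤ : α ≤ Q * η
      α≤ = ≤-trans (m<[1+m/n]*n β η) (*-monoˡ-≤ η (s≤s σ≤))

theorem28 : (h : ℕ → ℕ) ⦃ _ : ∀ {k} → NonZero (h k) ⦄ →
    ((λ α → h (n α)) ∈O[polylog-n] →
    (λ α → ẑ (h (n α)) (S α)) / (λ α → z (S α)) ∈Ω log[n] / loglog[n])
    × ((λ α → ẑ (h (n α)) (S α)) ∈O (λ α → z (S α)) →
    (λ α → h (n α)) ∈n^Ω[1])
theorem28 h = polylog⇒ratio h , linear⇒polynomial h
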